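{- Let $r \ge 1$ be odd, $a \ge 1$ be odd, $s\ge 0$ an integer, and let $t \ge 2$, or $t=1$ and $a < rt+s$. Then $$r \left\lceil \frac{tr+s}{a}\right\rceil + (t-1)r+1 \le \sigma(r,s,a,t) \le r \left\lceil\frac{tr+s+1}{a}\right\rceil + (t-1)r+1.$$ Moreover, if $d \ge r \left\lceil\frac{rt+s}{a}\right\rceil +(t-1)r+1$ then there are at least $t$ integer values of $x$ satisfying $\frac{d+s}{r+a} \le x < \frac{d}{r}$.
   Context: All graphs are finite simple graphs. A $(d,d+s)$-graph is a graph all of whose vertex degrees lie in $\{d, \ldots, d+s\}$. An $(r,r+a)$-factor of $G$ is a spanning subgraph all of whose degrees lie in $\{r,\ldots,r+a\}$; an $(r,r+a)$-factorization of $G$ with $x$ factors is a decomposition of $E(G)$ into $x$ edge-disjoint $(r,r+a)$-factors. $\sigma(r,s,a,t)$ is the least integer such that, whenever $d \ge \sigma(r,s,a,t)$, every simple $(d,d+s)$-graph has an $(r,r+a)$-factorization with $x$ factors for at least $t$ different values of $x$. -}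

module Defs where

open import Data.Nat using (ℕ; zero; suc; _+_; _*_; _∸_; _≤_; _<_)
open import Data.Nat.DivMod using (_/_)
open import Data.Bool using (Bool; true; false; _∧_; if_then_else_)
open import Data.Fin using (Fin; _≟_)
open import Data.List using (List; map)
open import Data.Nat.ListAction using (sum)
open import Data.List using () renaming (allFin to allFinL)
open import Data.Product using (Σ; ∃; _×_)
open import Function.Definitions using (Injective)
open import Relation.Binary.PropositionalEquality using (_≡_)
open import Relation.Nullary.Decidable using (⌊_⌋)

Odd : ℕ → Set
Odd n = ∃ λ k → n ≡ suc (2 * k)

-- ⌈ m / a ⌉ for a ≥ 1 (value 0 for a = 0, never used)
⌈_/_⌉ : ℕ → ℕ → ℕ
⌈ m / zero ⌉ = 0
⌈ m / suc k ⌉ = (m + k) / suc k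

countT : ∀ {n} → (Fin n → Bool) → ℕ
countT {n} p = sum (map (λ j → if p j then 1 else 0) (allFinL n))

record Graph (n : ℕ) : Set where
  field
    adj   : Fin n → Fin n → Bool
    sym   : ∀ i j → adj i j ≡ adj j i
    irrefl : ∀ i → adj i i ≡ false
open Graph public

degree : ∀ {n} → Graph n → Fin n → ℕ
degree G v = countT (adj G v)

IsDegBounded : ∀ {n} → ℕ → ℕ → Graph n → Set
IsDegBounded {n} d s G = ∀ v → d ≤ degree G v × degree G v ≤ d + s

-- An (r,r+a)-factorization of G with x factors: each edge gets exactly one
-- factor label in Fin x (labels symmetric: edge {u,v} has one label), so the
-- factors are edge-disjoint and cover E(G); every factor is a spanning
-- subgraph with all degrees in {r,...,r+a}.
record Factorization {n : ℕ} (G : Graph n) (r a x : ℕ) : Set where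
  field
    label    : Fin n → Fin n → Fin x
    labelSym : ∀ u v → label u v ≡ label v u
    degOK    : ∀ (k : Fin x) (v : Fin n) →
               r ≤ countT (λ w → adj G v w ∧ ⌊ label v w ≟ k ⌋)
               × countT (λ w → adj G v w ∧ ⌊ label v w ≟ k ⌋) ≤ r + a

ManyFactorizations : ∀ {n} → Graph n → ℕ → ℕ → ℕ → Set
ManyFactorizations G r a t =
  Σ (Fin t → ℕ) λ xs → Injective _≡_ _≡_ xs × (∀ i → Factorization G r a (xs i))

SigmaProp : ℕ → ℕ → ℕ → ℕ → ℕ → Set
SigmaProp r s a t d₀ =
  ∀ d → d₀ ≤ d → ∀ n (G : Graph n) → IsDegBounded d s G → ManyFactorizations G r a t

-- lo ≤ σ(r,s,a,t) ≤ hi, with σ the least d₀ satisfying SigmaProp: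
-- hi satisfies the property (so σ exists and σ ≤ hi), and every d₀
-- satisfying it is ≥ lo.
SigmaBetween : ℕ → ℕ → ℕ → ℕ → ℕ → ℕ → Set
SigmaBetween r s a t lo hi =
  SigmaProp r s a t hi × (∀ d₀ → SigmaProp r s a t d₀ → lo ≤ d₀)

{-# OPTIONS --safe #-}

-- Upper bound. If r x < deg v < (r + a) x for all v, a simple graph splits into x factors of the
-- required kind; this is a Vizing argument in which colours may repeat at a vertex. Vertices are
-- balanced one at a time. Suppose that all colour degrees are in range on a set P, and that at
-- z ∉ P there are two more edges of colour μ than of colour φ. Exchange φ and μ on a trail starting at
-- z. The only obstruction is that every neighbour y of z along μ lies in P, has equally many edges of
-- colours φ and μ, and this number is an end of the range; the strict inequality for deg y then
-- yields a colour κ occurring at y a different number of times. The excess at z can be passed from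
-- μ to κ, and repeating this gives a fan of neighbours of z whose colours eventually close up. At
-- that point a φ/μ-trail from the last vertex of the fan removes the obstruction somewhere.
--
-- Lower bound. With d = r x an (r, r + a)-factorization with x factors uses r-factors only on the
-- vertices of degree d. For odd r every r-factor meets the cut around an odd set of such vertices,
-- so a cut of at most one edge excludes x ≥ 2.
module Submission where

open import Defs hiding (sym)
open import Data.Bool using (Bool; true; false; _∧_; _∨_; not; if_then_else_)
open import Data.Bool.Properties using (∧-zeroʳ)
open import Data.Empty using (⊥; ⊥-elim)
open import Data.Fin using (Fin; zero; suc; _≟_; toℕ; fromℕ<; _↑ˡ_; _↑ʳ_; splitAt)
open import Data.Fin.Properties
  using (any?; injective⇒≤; pigeonhole; toℕ-injective; toℕ-fromℕ<; toℕ<n;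
         splitAt-↑ˡ; splitAt-↑ʳ; splitAt⁻¹-↑ˡ; splitAt⁻¹-↑ʳ)
open import Data.List using (List; []; _∷_; _∷ʳ_; length; lookup; tabulate)
open import Data.List.Membership.Propositional using (_∈_; _∉_)
open import Data.List.Membership.Propositional.Properties using (∈-lookup; ∈-++⁻)
open import Data.List.Properties using (length-++; map-tabulate)
open import Data.List.Relation.Unary.Any using (here; there)
open import Data.Maybe using (Maybe; just; nothing; is-just; fromMaybe)
open import Data.Maybe.Properties using (just-injective; ≡-dec)
open import Data.Nat using (ℕ; zero; suc; _+_; _*_; _∸_; _≤_; _<_; z≤n; s≤s; _<?_)
open import Data.Nat.DivMod using (_/_; m/n*n≤m; m≡m%n+[m/n]*n; m%n<n)
import Data.Nat.ListAction as List
open import Data.Nat.Properties hiding (_≟_)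
open import Data.Nat.Tactic.RingSolver using (solve-∀)
open import Data.Product using (Σ; ∃; _×_; _,_; proj₁; proj₂)
open import Data.Sum using (_⊎_; inj₁; inj₂)
open import Function.Definitions using (Injective)
open import Relation.Binary using (tri<; tri≈; tri>)
open import Relation.Binary.PropositionalEquality
  using (_≡_; _≢_; refl; sym; trans; cong; cong₂; subst; subst₂; ≢-sym; module ≡-Reasoning)
open import Relation.Nullary using (¬_; Dec; yes; no; does)
open import Relation.Nullary.Decidable using (⌊_⌋; isYes≗does; dec-true; dec-false)
open import Algebra.Properties.CommutativeMonoid.Sum +-0-commutativeMonoid
  using (sum; sum-cong-≗; ∑-distrib-+; ∑-comm; sum-replicate-zero)

-- Progress at `z` is measured by the sum of the squares of its colour degrees. A trail from `z`
-- lowers it unless the trail returns to `z` and moves two units across a gap of exactly two, which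
-- merely exchanges the two values; only this case needs the fan. Trails are harmless elsewhere,
-- because a trail stops as soon as its change evens out the two colours at the vertex reached.
-- Edges at `z` that must not be touched are uncoloured before a trail is made and coloured again
-- afterwards. A colour that a fan vertex sees a different number of times must occur at `z` exactly
-- once more than φ and once less than μ, since otherwise it could replace one of them; hence
-- passing the excess on leaves the measure unchanged. The upper bound has s + 1 where the count of
-- admissible x has s, because the splitting theorem needs strict inequality at the largest degree
-- too. The lower bound is tested at d = r (q + t - 1), where q is the ceiling: vertices of degree d
-- + s and d confine x to the t values q, ..., q + t - 1, and parity removes the last one.

-- Finite sums and the Kronecker delta

sum-zero : ∀ {n} {f : Fin n → ℕ} → (∀ i → f i ≡ 0) → sum f ≡ 0
sum-zero {n} f≡0 = trans (sum-cong-≗ f≡0) (sum-replicate-zero n)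

opaque
  δ : ∀ {n} → Fin n → Fin n → ℕ
  δ a b = if does (a ≟ b) then 1 else 0

  δ-refl : ∀ {n} (a : Fin n) → δ a a ≡ 1
  δ-refl a rewrite dec-true (a ≟ a) refl = refl

  δ-≢ : ∀ {n} {a b : Fin n} → a ≢ b → δ a b ≡ 0
  δ-≢ {a = a} {b} a≢b rewrite dec-false (a ≟ b) a≢b = refl

  sum-δ : ∀ {n} (a : Fin n) → sum (δ a) ≡ 1
  sum-δ {suc n} zero = cong suc (sum-zero {n} {λ _ → 0} λ _ → refl)
  sum-δ (suc a) = sum-δ a

  δ-comm : ∀ {n} (a b : Fin n) → δ a b ≡ δ b a
  δ-comm a b with a ≟ b | b ≟ a
  ... | yes _    | yes _    = refl
  ... | yes refl | no a≢a   = ⊥-elim (a≢a refl)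
  ... | no b≢b   | yes refl = ⊥-elim (b≢b refl)
  ... | no _     | no _     = refl

  δ-idem : ∀ {n} (a b : Fin n) → δ a b * δ a b ≡ δ a b
  δ-idem a b with a ≟ b
  ... | yes _ = refl
  ... | no _  = refl

sum-*ˡ : ∀ {n} c (f : Fin n → ℕ) → sum (λ i → c * f i) ≡ c * sum f
sum-*ˡ {zero}  c f = sym (*-zeroʳ c)
sum-*ˡ {suc n} c f = trans (cong (c * f zero +_) (sum-*ˡ c λ i → f (suc i)))
                           (sym (*-distribˡ-+ c (f zero) _))

sum-mono-≤ : ∀ {n} {f g : Fin n → ℕ} → (∀ i → f i ≤ g i) → sum f ≤ sum g
sum-mono-≤ {zero}  f≤g = z≤n
sum-mono-≤ {suc n} f≤g = +-mono-≤ (f≤g zero) (sum-mono-≤ λ i → f≤g (suc i))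

sum-const : ∀ n c → sum {n} (λ _ → c) ≡ n * c
sum-const zero    c = refl
sum-const (suc n) c = cong (c +_) (sum-const n c)

-- Partial edge colourings and alternating trails

-- A partial edge colouring: nothing marks both the non-edges and the uncoloured edges.
record Colouring (n x : ℕ) : Set where
  field
    lab     : Fin n → Fin n → Maybe (Fin x)
    lab-sym : ∀ v w → lab v w ≡ lab w v
    lab-irr : ∀ v → lab v v ≡ nothing
open Colouring

has : ∀ {x} → Maybe (Fin x) → Fin x → ℕ
has (just c) k = δ c k
has nothing  k = 0

has-≢ : ∀ {x} {m : Maybe (Fin x)} {k} → m ≢ just k → has m k ≡ 0
has-≢ {m = nothing} _  = refl
has-≢ {m = just c} {k} ≢k = δ-≢ {a = c} {k} λ { refl → ≢k refl }

opaque
  cnt : ∀ {n x} → Colouring n x → Fin n → Fin x → ℕ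
  cnt E v k = sum λ w → has (lab E v w) k

  -- The unit vector at the pair `(a , o)`: what one end of an `o`-coloured edge at `a` contributes
  -- to the table of colour degrees.
  I : ∀ {n x} → Fin n → Fin x → Fin n → Fin x → ℕ
  I a o v k = δ a v * δ o k

  I-at : ∀ {n x} (v : Fin n) (o k : Fin x) → I v o v k ≡ δ o k
  I-at v o k rewrite δ-refl v = *-identityˡ (δ o k)

  I-refl : ∀ {n x} (a : Fin n) (o : Fin x) → I a o a o ≡ 1
  I-refl a o rewrite δ-refl a | δ-refl o = refl

  I-≢ˡ : ∀ {n x} {a v : Fin n} {o k : Fin x} → a ≢ v → I a o v k ≡ 0
  I-≢ˡ a≢v rewrite δ-≢ a≢v = refl

  I-≢ʳ : ∀ {n x} {a v : Fin n} {o k : Fin x} → o ≢ k → I a o v k ≡ 0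
  I-≢ʳ {a = a} {v} o≢k rewrite δ-≢ o≢k = *-zeroʳ (δ a v)

private
  joins : ∀ {n} → Fin n → Fin n → Fin n → Fin n → Bool
  joins a b v w = (does (a ≟ v) ∧ does (b ≟ w)) ∨ (does (b ≟ v) ∧ does (a ≟ w))

  joins-sym : ∀ {n} (a b v w : Fin n) → joins a b v w ≡ joins a b w v
  joins-sym a b v w with does (a ≟ v) | does (b ≟ w) | does (b ≟ v) | does (a ≟ w)
  ... | true  | true  | true  | true  = refl
  ... | true  | true  | true  | false = refl
  ... | true  | true  | false | true  = refl
  ... | true  | true  | false | false = refl
  ... | true  | false | true  | true  = refl
  ... | true  | false | true  | false = refl
  ... | true  | false | false | true  = refl
  ... | true  | false | false | false = refl
  ... | false | true  | true  | true  = refl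
  ... | false | true  | true  | false = refl
  ... | false | true  | false | true  = refl
  ... | false | true  | false | false = refl
  ... | false | false | true  | true  = refl
  ... | false | false | true  | false = refl
  ... | false | false | false | true  = refl
  ... | false | false | false | false = refl

  joins-irr : ∀ {n} {a b : Fin n} → a ≢ b → ∀ v → joins a b v v ≡ false
  joins-irr {a = a} {b} a≢b v with a ≟ v | b ≟ v
  ... | yes refl | yes refl = ⊥-elim (a≢b refl)
  ... | yes _    | no _     = refl
  ... | no _     | yes _    = refl
  ... | no _     | no _     = refl

  joins-true : ∀ {n} (a b v w : Fin n) → joins a b v w ≡ true →
               (a ≡ v × b ≡ w) ⊎ (b ≡ v × a ≡ w)
  joins-true a b v w eq with a ≟ v | b ≟ w | b ≟ v | a ≟ w
  ... | yes p | yes q | _     | _     = inj₁ (p , q)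
  ... | yes _ | no _  | yes p | yes q = inj₂ (p , q)
  ... | no _  | _     | yes p | yes q = inj₂ (p , q)

  opaque
    unfolding δ

    joins-weight : ∀ {n} {a b : Fin n} → a ≢ b → ∀ v w →
                   (if joins a b v w then 1 else 0) ≡ δ a v * δ b w + δ b v * δ a w
    joins-weight {a = a} {b} a≢b v w with a ≟ v | b ≟ w | b ≟ v | a ≟ w
    ... | yes refl | _ | yes refl | _ = ⊥-elim (a≢b refl)
    ... | yes _ | yes _ | no _  | yes _ = refl
    ... | yes _ | yes _ | no _  | no _  = refl
    ... | yes _ | no _  | no _  | yes _ = refl
    ... | yes _ | no _  | no _  | no _  = refl
    ... | no _  | yes _ | yes _ | yes _ = refl
    ... | no _  | yes _ | yes _ | no _  = refl
    ... | no _  | yes _ | no _  | yes _ = refl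
    ... | no _  | yes _ | no _  | no _  = refl
    ... | no _  | no _  | yes _ | yes _ = refl
    ... | no _  | no _  | yes _ | no _  = refl
    ... | no _  | no _  | no _  | yes _ = refl
    ... | no _  | no _  | no _  | no _  = refl

  sum-joins : ∀ {n} {a b : Fin n} → a ≢ b → ∀ v →
              sum (λ w → if joins a b v w then 1 else 0) ≡ δ a v + δ b v
  sum-joins {a = a} {b} a≢b v = begin
    sum (λ w → if joins a b v w then 1 else 0)       ≡⟨ sum-cong-≗ (joins-weight a≢b v) ⟩
    sum (λ w → δ a v * δ b w + δ b v * δ a w)        ≡⟨ ∑-distrib-+ (λ w → δ a v * δ b w) _ ⟩
    sum (λ w → δ a v * δ b w) + sum (λ w → δ b v * δ a w)
      ≡⟨ cong₂ _+_ (sum-*ˡ (δ a v) (δ b)) (sum-*ˡ (δ b v) (δ a)) ⟩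
    δ a v * sum (δ b) + δ b v * sum (δ a)
      ≡⟨ cong₂ (λ i j → δ a v * i + δ b v * j) (sum-δ b) (sum-δ a) ⟩
    δ a v * 1 + δ b v * 1                            ≡⟨ cong₂ _+_ (*-identityʳ (δ a v)) (*-identityʳ (δ b v)) ⟩
    δ a v + δ b v                                    ∎
    where open ≡-Reasoning

data Same? {n} (a b v w : Fin n) : Set where
  straight : a ≡ v → b ≡ w → Same? a b v w
  crossed  : b ≡ v → a ≡ w → Same? a b v w
  apart    : ¬ (a ≡ v × b ≡ w) → ¬ (b ≡ v × a ≡ w) → Same? a b v w

same? : ∀ {n} (a b v w : Fin n) → Same? a b v w
same? a b v w with a ≟ v | b ≟ w | b ≟ v | a ≟ w
... | yes p | yes q | _     | _     = straight p q
... | yes _ | no ¬q | yes p | yes q = crossed p q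
... | no ¬p | _     | yes p | yes q = crossed p q
... | yes _ | no ¬q | no ¬p | _     = apart (λ h → ¬q (proj₂ h)) (λ h → ¬p (proj₁ h))
... | yes _ | no ¬q | _     | no ¬p = apart (λ h → ¬q (proj₂ h)) (λ h → ¬p (proj₂ h))
... | no ¬q | _     | no ¬p | _     = apart (λ h → ¬q (proj₁ h)) (λ h → ¬p (proj₁ h))
... | no ¬q | _     | _     | no ¬p = apart (λ h → ¬q (proj₁ h)) (λ h → ¬p (proj₂ h))

unlabelled : ∀ {x} {m : Maybe (Fin x)} → is-just m ≡ false → m ≡ nothing
unlabelled {m = nothing} _ = refl

module _ {n x : ℕ} where

  opaque
    set : (E : Colouring n x) (a b : Fin n) → a ≢ b → Maybe (Fin x) → Colouring n x
    set E a b a≢b m = record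
      { lab     = λ v w → if joins a b v w then m else lab E v w
      ; lab-sym = λ v w → cong₂ (λ c l → if c then m else l) (joins-sym a b v w) (lab-sym E v w)
      ; lab-irr = λ v → trans (cong (λ c → if c then m else lab E v v) (joins-irr a≢b v)) (lab-irr E v)
      }

    set-at : ∀ E a b (a≢b : a ≢ b) m → lab (set E a b a≢b m) a b ≡ m
    set-at E a b a≢b m rewrite dec-true (a ≟ a) refl | dec-true (b ≟ b) refl = refl

    set-other : ∀ E a b (a≢b : a ≢ b) m v w → ¬ (a ≡ v × b ≡ w) → ¬ (b ≡ v × a ≡ w) →
                lab (set E a b a≢b m) v w ≡ lab E v w
    set-other E a b a≢b m v w h₁ h₂ with joins a b v w in eq
    ... | false = refl
    ... | true with joins-true a b v w eq
    ...   | inj₁ h = ⊥-elim (h₁ h)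
    ...   | inj₂ h = ⊥-elim (h₂ h)

  set-at′ : ∀ E a b (a≢b : a ≢ b) m → lab (set E a b a≢b m) b a ≡ m
  set-at′ E a b a≢b m = trans (lab-sym (set E a b a≢b m) b a) (set-at E a b a≢b m)

  -- Uncolouring the edge ab, recolouring other edges and colouring ab again.
  module _ (E F : Colouring n x) (a b : Fin n) (a≢b : a ≢ b) (k : Fin x) where

    put-support : is-just (lab E a b) ≡ true →
      (∀ v w → is-just (lab F v w) ≡ is-just (lab (set E a b a≢b nothing) v w)) →
      ∀ v w → is-just (lab (set F a b a≢b (just k)) v w) ≡ is-just (lab E v w)
    put-support ab sup v w with same? a b v w
    ... | straight refl refl = trans (cong is-just (set-at F a b a≢b (just k))) (sym ab)
    ... | crossed refl refl = trans (cong is-just (set-at′ F a b a≢b (just k)))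
                                (sym (trans (cong is-just (lab-sym E b a)) ab))
    ... | apart h₁ h₂ = trans (cong is-just (set-other F a b a≢b _ v w h₁ h₂))
                          (trans (sup v w) (cong is-just (set-other E a b a≢b _ v w h₁ h₂)))

    put-keep : ∀ {c} → lab E a b ≢ just c →
      (∀ v w → lab (set E a b a≢b nothing) v w ≡ just c → lab F v w ≡ just c) →
      ∀ v w → lab E v w ≡ just c → lab (set F a b a≢b (just k)) v w ≡ just c
    put-keep ab≢c kp v w eq with same? a b v w
    ... | straight refl refl = ⊥-elim (ab≢c eq)
    ... | crossed refl refl = ⊥-elim (ab≢c (trans (lab-sym E a b) eq))
    ... | apart h₁ h₂ = trans (set-other F a b a≢b _ v w h₁ h₂)
                          (kp v w (trans (set-other E a b a≢b _ v w h₁ h₂) eq))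

  opaque
    unfolding cnt set

    -- The contribution of the old label is added on the left rather than subtracted on the right,
    -- so a single equation in ℕ serves both for uncolouring and for colouring an edge.
    cnt-set : ∀ E a b (a≢b : a ≢ b) m v k →
              (δ a v + δ b v) * has (lab E a b) k + cnt (set E a b a≢b m) v k
              ≡ (δ a v + δ b v) * has m k + cnt E v k
    cnt-set E a b a≢b m v k = begin
      (δ a v + δ b v) * old + cnt E′ v k
        ≡⟨ cong (_+ cnt E′ v k) (weigh old) ⟨
      sum (λ w → old * s w) + cnt E′ v k
        ≡⟨ ∑-distrib-+ (λ w → old * s w) _ ⟨
      sum (λ w → old * s w + has (lab E′ v w) k)
        ≡⟨ sum-cong-≗ swap ⟩
      sum (λ w → has m k * s w + has (lab E v w) k)
        ≡⟨ ∑-distrib-+ (λ w → has m k * s w) _ ⟩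
      sum (λ w → has m k * s w) + cnt E v k
        ≡⟨ cong (_+ cnt E v k) (weigh (has m k)) ⟩
      (δ a v + δ b v) * has m k + cnt E v k ∎
      where
      open ≡-Reasoning
      E′ : Colouring n x
      E′ = set E a b a≢b m
      old : ℕ
      old = has (lab E a b) k
      s : Fin n → ℕ
      s w = if joins a b v w then 1 else 0
      weigh : ∀ c → sum (λ w → c * s w) ≡ (δ a v + δ b v) * c
      weigh c = trans (sum-*ˡ c s) (trans (cong (c *_) (sum-joins a≢b v)) (*-comm c _))
      swap : ∀ w → old * s w + has (lab E′ v w) k ≡ has m k * s w + has (lab E v w) k
      swap w with joins a b v w in eq
      ... | false = cong₂ _+_ (trans (*-zeroʳ old) (sym (*-zeroʳ (has m k)))) refl
      ... | true with joins-true a b v w eq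
      ...   | inj₁ (refl , refl) =
        trans (cong (_+ has m k) (*-identityʳ old))
              (trans (+-comm old _) (cong (_+ old) (sym (*-identityʳ (has m k)))))
      ...   | inj₂ (refl , refl) rewrite lab-sym E b a =
        trans (cong (_+ has m k) (*-identityʳ old))
              (trans (+-comm old _) (cong (_+ old) (sym (*-identityʳ (has m k)))))

  module _ (E : Colouring n x) (a b : Fin n) (a≢b : a ≢ b) where

    opaque
      unfolding I

      cnt-remove : ∀ {o} → lab E a b ≡ just o → ∀ v k →
                   I a o v k + (I b o v k + cnt (set E a b a≢b nothing) v k) ≡ cnt E v k
      cnt-remove {o} eq v k = begin
        I a o v k + (I b o v k + c₀)       ≡⟨ +-assoc (I a o v k) _ _ ⟨
        I a o v k + I b o v k + c₀         ≡⟨ cong (_+ c₀) (*-distribʳ-+ (δ o k) (δ a v) _) ⟨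
        (δ a v + δ b v) * δ o k + c₀       ≡⟨ cong (λ m → (δ a v + δ b v) * has m k + c₀) eq ⟨
        (δ a v + δ b v) * has (lab E a b) k + c₀  ≡⟨ cnt-set E a b a≢b nothing v k ⟩
        (δ a v + δ b v) * 0 + cnt E v k    ≡⟨ cong (_+ cnt E v k) (*-zeroʳ (δ a v + δ b v)) ⟩
        cnt E v k                          ∎
        where
        open ≡-Reasoning
        c₀ : ℕ
        c₀ = cnt (set E a b a≢b nothing) v k

      cnt-add : lab E a b ≡ nothing → ∀ o v k →
                cnt (set E a b a≢b (just o)) v k ≡ I a o v k + (I b o v k + cnt E v k)
      cnt-add eq o v k = begin
        c₁                                       ≡⟨ cong (_+ c₁) (*-zeroʳ (δ a v + δ b v)) ⟨
        (δ a v + δ b v) * 0 + c₁                 ≡⟨ cong (λ m → (δ a v + δ b v) * has m k + c₁) eq ⟨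
        (δ a v + δ b v) * has (lab E a b) k + c₁ ≡⟨ cnt-set E a b a≢b (just o) v k ⟩
        (δ a v + δ b v) * δ o k + cnt E v k      ≡⟨ cong (_+ cnt E v k) (*-distribʳ-+ (δ o k) (δ a v) _) ⟩
        I a o v k + I b o v k + cnt E v k        ≡⟨ +-assoc (I a o v k) _ _ ⟩
        I a o v k + (I b o v k + cnt E v k)      ∎
        where
        open ≡-Reasoning
        c₁ : ℕ
        c₁ = cnt (set E a b a≢b (just o)) v k

  opaque
    unfolding cnt

    neighbour : ∀ (E : Colouring n x) v (k : Fin x) → 1 ≤ cnt E v k → ∃ λ (w : Fin n) → lab E v w ≡ just k
    neighbour E v k 1≤c with any? (λ w → ≡-dec _≟_ (lab E v w) (just k))
    ... | yes found = found
    ... | no none   = ⊥-elim (<⇒≢ 1≤c (sym (sum-zero λ w → has-≢ (λ eq → none (w , eq)))))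

  edge-distinct : ∀ (E : Colouring n x) {v w k} → lab E v w ≡ just k → v ≢ w
  edge-distinct E {v} eq refl with trans (sym eq) (lab-irr E v)
  ... | ()

  -- E′ arises from E by exchanging o and ō along a trail that leaves w through an o-edge and
  -- enters its last vertex, end, through an edge that was coloured into.
  record TrailFrom (E : Colouring n x) (w : Fin n) (o ō : Fin x) : Set where
    field
      E′       : Colouring n x
      end      : Fin n
      into out : Fin x
      dir      : (into ≡ o × out ≡ ō) ⊎ (into ≡ ō × out ≡ o)
      -- Passages through inner vertices cancel, since the trail enters and leaves in opposite
      -- colours. Units lost at the two ends are added to `E′` and units gained to `E`, which avoids
      -- subtraction.
      moves    : ∀ v k → I w o v k + (I end into v k + cnt E′ v k)
                       ≡ I w ō v k + (I end out v k + cnt E v k)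
      -- The `I` terms matter only if the trail returns to `w`: its first edge is then discounted in
      -- the comparison.
      stop     : cnt E end out + I w o end into < cnt E end into + I w o end out
      support  : ∀ v u → is-just (lab E′ v u) ≡ is-just (lab E v u)
      keep     : ∀ v u k → k ≢ o → k ≢ ō → lab E v u ≡ just k → lab E′ v u ≡ just k

  -- Every edge of the two colours is counted at both ends. A trail uncolours the edge it has just
  -- used, so this number decreases and bounds its length.
  size : Colouring n x → Fin x → Fin x → ℕ
  size E o ō = sum (λ v → cnt E v o) + sum (λ v → cnt E v ō)

  size-swap : ∀ E o ō → size E o ō ≡ size E ō o
  size-swap E o ō = +-comm (sum λ v → cnt E v o) _

  private
    opaque
      unfolding I

      size-remove : ∀ E a b (a≢b : a ≢ b) {o} → lab E a b ≡ just o → ∀ ō →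
                    size (set E a b a≢b nothing) o ō < size E o ō
      size-remove E a b a≢b {o} eq ō =
        +-mono-<-≤ (≤-trans (≤-reflexive (cong (_+ sum (λ v → cnt E₀ v o)) (sym (sum-δ a))))
                     (≤-trans (≤-reflexive (sym (∑-distrib-+ (δ a) (λ v → cnt E₀ v o))))
                              (sum-mono-≤ λ v → ≤-trans (+-mono-≤ (≤-reflexive (Io v)) (m≤n+m _ (I b o v o)))
                                                        (≤-reflexive (cnt-remove E a b a≢b eq v o)))))
                   (sum-mono-≤ λ v → ≤-trans (m≤n+m _ (I b o v ō))
                     (≤-trans (m≤n+m _ (I a o v ō)) (≤-reflexive (cnt-remove E a b a≢b eq v ō))))
        where
        E₀ : Colouring n x
        E₀ = set E a b a≢b nothing
        Io : ∀ v → δ a v ≡ I a o v o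
        Io v = sym (trans (cong (δ a v *_) (δ-refl o)) (*-identityʳ (δ a v)))

      I-swap : ∀ (v u : Fin n) {o ō into out : Fin x} → (into ≡ ō × out ≡ o) ⊎ (into ≡ o × out ≡ ō) →
               I v ō u into ≡ I v o u out
      I-swap v u {o} {ō} (inj₁ (refl , refl)) = cong (δ v u *_) (trans (δ-refl ō) (sym (δ-refl o)))
      I-swap v u {o} {ō} (inj₂ (refl , refl)) = cong (δ v u *_) (δ-comm ō o)

      I-swap′ : ∀ (v u : Fin n) {o ō into out : Fin x} → (into ≡ ō × out ≡ o) ⊎ (into ≡ o × out ≡ ō) →
                I v ō u out ≡ I v o u into
      I-swap′ v u (inj₁ (p , q)) = I-swap v u (inj₂ (q , p))
      I-swap′ v u (inj₂ (p , q)) = I-swap v u (inj₁ (q , p))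

    swap-dir : ∀ {o ō into out : Fin x} → (into ≡ ō × out ≡ o) ⊎ (into ≡ o × out ≡ ō) →
               (into ≡ o × out ≡ ō) ⊎ (into ≡ ō × out ≡ o)
    swap-dir (inj₁ p) = inj₂ p
    swap-dir (inj₂ p) = inj₁ p

    shift₁ : ∀ a b c d e → a + (b + (c + (d + e))) ≡ a + c + (d + (b + e))
    shift₁ = solve-∀
    shift₂ : ∀ a b c d e → a + b + (c + (d + e)) ≡ b + (d + (a + (c + e)))
    shift₂ = solve-∀
    shift₃ : ∀ a b c d → a + (b + c) + d ≡ c + b + (a + d)
    shift₃ = solve-∀
    shift₄ : ∀ a b c d → a + b + (c + d) ≡ c + (d + a) + b
    shift₄ = solve-∀

  -- A trail stops at the first vertex where exchanging the colours of the last edge does not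
  -- increase the imbalance between o and ō; elsewhere there is an edge to continue along.
  walk : ∀ N (E : Colouring n x) (w : Fin n) (o ō : Fin x) → o ≢ ō → size E o ō ≤ N → 1 ≤ cnt E w o → TrailFrom E w o ō
  walk zero E w o ō o≢ō size≤0 1≤c with neighbour E w o 1≤c
  ... | v , eq = ⊥-elim (n≮0 (<-≤-trans (size-remove E w v (edge-distinct E eq) eq ō) size≤0))
  walk (suc N) E w o ō o≢ō size≤ 1≤c with neighbour E w o 1≤c
  ... | v , eq = go (cnt E v ō <? cnt E v o)
    where
    w≢v = edge-distinct E eq
    E₀ = set E w v w≢v nothing

    e₀ : ∀ u k → I w o u k + (I v o u k + cnt E₀ u k) ≡ cnt E u k
    e₀ = cnt-remove E w v w≢v eq

    ≢k : ∀ {k} → k ≢ o → lab E w v ≢ just k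
    ≢k k≢o p = k≢o (just-injective (trans (sym p) eq))

    go : _ → TrailFrom E w o ō
    go (yes lt) = record
      { E′ = set E₀ w v w≢v (just ō)
      ; end = v ; into = o ; out = ō ; dir = inj₁ (refl , refl)
      ; moves = λ u k → trans
          (cong (λ c → I w o u k + (I v o u k + c)) (cnt-add E₀ w v w≢v (set-at E w v w≢v nothing) ō u k))
          (trans (assoc₅ (I w o u k) (I v o u k) (I w ō u k) (I v ō u k) (cnt E₀ u k))
                 (cong (λ c → I w ō u k + (I v ō u k + c)) (e₀ u k)))
      ; stop = subst (λ i → cnt E v ō + i < cnt E v o + I w o v ō) (sym (I-≢ˡ {o = o} w≢v))
                 (subst (λ i → cnt E v ō + 0 < cnt E v o + i) (sym (I-≢ˡ {o = o} w≢v))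
                   (+-monoˡ-< 0 lt))
      ; support = put-support E E₀ w v w≢v ō (cong is-just eq) (λ _ _ → refl)
      ; keep = λ a b k k≢o _ → put-keep E E₀ w v w≢v ō (≢k k≢o) (λ _ _ p → p) a b
      }
      where
      assoc₅ : ∀ a b c d e → a + (b + (c + (d + e))) ≡ c + (d + (a + (b + e)))
      assoc₅ = solve-∀
    go (no ≮) = record
      { E′ = set R.E′ w v w≢v (just ō)
      ; end = R.end ; into = R.into ; out = R.out ; dir = swap-dir R.dir
      ; moves = mv
      ; stop = st
      ; support = put-support E R.E′ w v w≢v ō (cong is-just eq) R.support
      ; keep = λ a b k k≢o k≢ō → put-keep E R.E′ w v w≢v ō (≢k k≢o) (λ v w → R.keep v w k k≢ō k≢o) a b
      }
      where
      -- The edge `wv` has colour `o` and `ō` is at least as frequent at `v`, so there is an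
      -- `ō`-edge to continue along, and removing `wv` does not affect it.
      1≤co : 1 ≤ cnt E v o
      1≤co = ≤-trans (≤-trans (≤-reflexive (sym (I-refl v o))) (m≤m+n _ _))
               (≤-trans (m≤n+m _ (I w o v o)) (≤-reflexive (e₀ v o)))
      1≤cō : 1 ≤ cnt E₀ v ō
      1≤cō = subst (1 ≤_) (trans (sym (e₀ v ō))
               (cong₂ (λ i j → i + (j + cnt E₀ v ō)) (I-≢ˡ {o = o} {k = ō} w≢v) (I-≢ʳ {a = v} {v} o≢ō)))
               (≤-trans 1≤co (≮⇒≥ ≮))
      size₀ : size E₀ ō o ≤ N
      size₀ = ≤-pred (<-≤-trans (subst (_< size E o ō) (size-swap E₀ o ō) (size-remove E w v w≢v eq ō)) size≤)
      R′ : TrailFrom E₀ v ō o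
      R′ = walk N E₀ v ō o (≢-sym o≢ō) size₀ 1≤cō
      module R = TrailFrom R′
      mv : ∀ u k → I w o u k + (I R.end R.into u k + cnt (set R.E′ w v w≢v (just ō)) u k)
                 ≡ I w ō u k + (I R.end R.out u k + cnt E u k)
      mv u k = begin
        wo + (ei + cnt (set R.E′ w v w≢v (just ō)) u k)
          ≡⟨ cong (λ c → wo + (ei + c))
                (cnt-add R.E′ w v w≢v (unlabelled (trans (R.support w v) (cong is-just (set-at E w v w≢v nothing)))) ō u k) ⟩
        wo + (ei + (wō + (vō + c₁)))   ≡⟨ shift₁ wo ei wō vō c₁ ⟩
        wo + wō + (vō + (ei + c₁))     ≡⟨ cong (wo + wō +_) (R.moves u k) ⟩
        wo + wō + (vo + (eo + c₀))     ≡⟨ shift₂ wo wō vo eo c₀ ⟩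
        wō + (eo + (wo + (vo + c₀)))   ≡⟨ cong (λ c → wō + (eo + c)) (e₀ u k) ⟩
        wō + (eo + cnt E u k)          ∎
        where
        open ≡-Reasoning
        wo = I w o u k
        wō = I w ō u k
        vo = I v o u k
        vō = I v ō u k
        ei = I R.end R.into u k
        eo = I R.end R.out u k
        c₀ = cnt E₀ u k
        c₁ = cnt R.E′ u k
      st : cnt E R.end R.out + I w o R.end R.into < cnt E R.end R.into + I w o R.end R.out
      -- At `v` the removed `o`-edge and the discounted first `ō`-edge of the remaining trail
      -- balance each other; at `w` only the removed edge has to be accounted for.
      st = begin-strict
        cnt E e out + wi       ≡⟨ cong (_+ wi) (sym (e₀ e out)) ⟩
        wt + (vt + cnt E₀ e out) + wi ≡⟨ shift₃ wt vt (cnt E₀ e out) wi ⟩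
        cnt E₀ e out + vt + (wt + wi) ≡⟨ cong (λ i → cnt E₀ e out + i + (wt + wi)) (I-swap v e R.dir) ⟨
        cnt E₀ e out + I v ō e into + (wt + wi) <⟨ +-monoˡ-< (wt + wi) R.stop ⟩
        cnt E₀ e into + I v ō e out + (wt + wi) ≡⟨ cong (λ i → cnt E₀ e into + i + (wt + wi)) (I-swap′ v e R.dir) ⟩
        cnt E₀ e into + vi + (wt + wi) ≡⟨ shift₄ (cnt E₀ e into) vi wt wi ⟩
        wt + (wi + (cnt E₀ e into)) + vi  ≡⟨ fin wt wi (cnt E₀ e into) vi ⟩
        wi + (vi + cnt E₀ e into) + wt ≡⟨ cong (_+ wt) (e₀ e into) ⟩
        cnt E e into + wt ∎
        where
        open ≤-Reasoning
        e = R.end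
        into = R.into
        out = R.out
        wi = I w o e into
        wt = I w o e out
        vi = I v o e into
        vt = I v o e out
        fin : ∀ a b c d → a + (b + c) + d ≡ b + (d + c) + a
        fin = solve-∀

-- Changes of the colour degrees at a single vertex

module _ {x : ℕ} where

  private variable
    f g h f₀ g₀ : Fin x → ℕ
    a b c : Fin x

  Same : (f g : Fin x → ℕ) → Set
  Same f g = ∀ k → g k ≡ f k

  -- Move f g a b: g arises from f by moving one unit from a to b.
  Move : (f g : Fin x → ℕ) (a b : Fin x) → Set
  Move f g a b = ∀ k → δ a k + g k ≡ δ b k + f k

  Twice : (f g : Fin x → ℕ) (a b : Fin x) → Set
  Twice f g a b = ∀ k → δ a k + (δ a k + g k) ≡ δ b k + (δ b k + f k)

  Drop : (f g : Fin x → ℕ) (a : Fin x) → Set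
  Drop f g a = ∀ k → δ a k + g k ≡ f k

  drop-at : Drop f g a → suc (g a) ≡ f a
  drop-at {g = g} {a} d = trans (cong (_+ g a) (sym (δ-refl a))) (d a)

  drop-off : Drop f g a → ∀ {k} → a ≢ k → g k ≡ f k
  drop-off {g = g} d {k} a≢k = trans (cong (_+ g k) (sym (δ-≢ a≢k))) (d k)

  move-from : Move f g a b → a ≢ b → suc (g a) ≡ f a
  move-from {f = f} {g} {a} m a≢b =
    trans (cong (_+ g a) (sym (δ-refl a))) (trans (m a) (cong (_+ f a) (δ-≢ (≢-sym a≢b))))

  move-to : Move f g a b → a ≢ b → g b ≡ suc (f b)
  move-to {f = f} {g} {b = b} m a≢b =
    trans (cong (_+ g b) (sym (δ-≢ a≢b))) (trans (m b) (cong (_+ f b) (δ-refl b)))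

  move-off : Move f g a b → ∀ {k} → a ≢ k → b ≢ k → g k ≡ f k
  move-off {f = f} {g} m {k} a≢k b≢k =
    trans (cong (_+ g k) (sym (δ-≢ a≢k))) (trans (m k) (cong (_+ f k) (δ-≢ b≢k)))

  twice-from : Twice f g a b → a ≢ b → 2 + g a ≡ f a
  twice-from {f = f} {g} {a} m a≢b =
    trans (cong (λ i → i + (i + g a)) (sym (δ-refl a)))
          (trans (m a) (cong (λ i → i + (i + f a)) (δ-≢ (≢-sym a≢b))))

  twice-to : Twice f g a b → a ≢ b → g b ≡ 2 + f b
  twice-to {f = f} {g} {b = b} m a≢b =
    trans (cong (λ i → i + (i + g b)) (sym (δ-≢ a≢b)))
          (trans (m b) (cong (λ i → i + (i + f b)) (δ-refl b)))

  twice-off : Twice f g a b → ∀ {k} → a ≢ k → b ≢ k → g k ≡ f k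
  twice-off {f = f} {g} m {k} a≢k b≢k =
    trans (cong (λ i → i + (i + g k)) (sym (δ-≢ a≢k)))
          (trans (m k) (cong (λ i → i + (i + f k)) (δ-≢ b≢k)))

  same-trans : Same f g → Same g h → Same f h
  same-trans s t k = trans (t k) (s k)

  same-sym : Same f g → Same g f
  same-sym s k = sym (s k)

  move-resp : Same f f₀ → Same g g₀ → Move f₀ g₀ a b → Move f g a b
  move-resp {a = a} {b} s t m k = trans (cong (δ a k +_) (sym (t k))) (trans (m k) (cong (δ b k +_) (s k)))

  twice-resp : Same f f₀ → Same g g₀ → Twice f₀ g₀ a b → Twice f g a b
  twice-resp {a = a} {b} s t m k =
    trans (cong (λ i → δ a k + (δ a k + i)) (sym (t k)))
          (trans (m k) (cong (λ i → δ b k + (δ b k + i)) (s k)))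

  private
    exch : ∀ i j l → i + (j + l) ≡ j + (i + l)
    exch = solve-∀

  drop-same-add : Drop f f₀ a → Same f₀ g₀ → Drop g g₀ b → Move f g a b
  drop-same-add {f₀ = f₀} {a = a} {b = b} d s e k =
    trans (cong (δ a k +_) (trans (sym (e k)) (cong (δ b k +_) (s k))))
          (trans (exch (δ a k) (δ b k) (f₀ k)) (cong (δ b k +_) (d k)))

  drop-same-restore : Drop f f₀ a → Same f₀ g₀ → Drop g g₀ a → Same f g
  drop-same-restore {a = a} d s e k = trans (sym (e k)) (trans (cong (δ a k +_) (s k)) (d k))

  drop-move-restore : Drop f f₀ c → Move f₀ g₀ a b → Drop g g₀ c → Move f g a b
  drop-move-restore {f₀ = f₀} {c = c} {g₀ = g₀} {a} {b} d m e k =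
    trans (cong (δ a k +_) (sym (e k)))
      (trans (exch (δ a k) (δ c k) (g₀ k))
        (trans (cong (δ c k +_) (m k))
          (trans (exch (δ c k) (δ b k) (f₀ k)) (cong (δ b k +_) (d k)))))

  drop-move-add : Drop f f₀ b → Move f₀ g₀ a b → Drop g g₀ a → Same f g
  drop-move-add d m e k = trans (sym (e k)) (trans (m k) (d k))

  drop-twice-add : Drop f f₀ b → Twice f₀ g₀ a b → Drop g g₀ a → Move f g a b
  drop-twice-add {b = b} {a = a} d m e k =
    trans (cong (δ a k +_) (sym (e k))) (trans (m k) (cong (δ b k +_) (d k)))

  drop-twice-restore : Drop f f₀ c → Twice f₀ g₀ a b → Drop g g₀ c → Twice f g a b
  drop-twice-restore {f₀ = f₀} {c = c} {g₀ = g₀} {a} {b} d m e k =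
    trans (cong (λ i → δ a k + (δ a k + i)) (sym (e k)))
      (trans (pull (δ a k) (δ c k) (g₀ k))
        (trans (cong (δ c k +_) (m k))
          (trans (sym (pull (δ b k) (δ c k) (f₀ k))) (cong (λ i → δ b k + (δ b k + i)) (d k)))))
    where
    pull : ∀ i j l → i + (i + (j + l)) ≡ j + (i + (i + l))
    pull = solve-∀

  move-move : Move f g a b → Move g h a b → Twice f h a b
  move-move {f} {g} {a} {b} m₁ m₂ k =
    trans (cong (δ a k +_) (m₂ k)) (trans (exch (δ a k) (δ b k) (g k)) (cong (δ b k +_) (m₁ k)))

  move-back : Move f g a b → Move g h b a → Same f h
  move-back {a = a} {b} m₁ m₂ k = +-cancelˡ-≡ (δ b k) _ _ (trans (m₂ k) (m₁ k))

  Within : ℕ → ℕ → (Fin x → ℕ) → Set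
  Within l u f = ∀ k → l ≤ f k × f k ≤ u

  module _ {l u : ℕ} where

    within-same : Same f g → Within l u f → Within l u g
    within-same s w k rewrite s k = w k

    -- Both changed values stay between `f b` and `f a`, so no room at the ends of the range is
    -- required.
    within-move : Move f g a b → f b < f a → Within l u f → Within l u g
    within-move {f} {g} {a} {b} m lt w k with a ≟ k | b ≟ k
    ... | yes refl | yes refl = ⊥-elim (<-irrefl refl lt)
    ... | yes refl | no b≢a = ≤-trans (proj₁ (w b)) (≤-pred (subst (f b <_) (sym eq) lt))
                            , ≤-trans (n≤1+n _) (subst (_≤ u) (sym eq) (proj₂ (w k)))
      where eq = move-from m (≢-sym b≢a)
    ... | no a≢b | yes refl rewrite move-to m a≢b =
      ≤-trans (proj₁ (w b)) (n≤1+n _) , ≤-trans lt (proj₂ (w a))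
    ... | no a≢k | no b≢k rewrite move-off m a≢k b≢k = w k

    within-spread : Move f g a b → l < f a → f b < u → Within l u f → Within l u g
    within-spread {f} {g} {a} {b} m l< <u w k with a ≟ k | b ≟ k
    ... | yes refl | yes refl = subst (λ i → l ≤ i × i ≤ u) (sym (+-cancelˡ-≡ (δ a k) _ _ (m k))) (w k)
    ... | yes refl | no b≢a = ≤-pred (subst (l <_) (sym eq) l<)
                            , ≤-trans (n≤1+n _) (subst (_≤ u) (sym eq) (proj₂ (w k)))
      where eq = move-from m (≢-sym b≢a)
    ... | no a≢b | yes refl rewrite move-to m a≢b = ≤-trans (proj₁ (w b)) (n≤1+n _) , <u
    ... | no a≢k | no b≢k rewrite move-off m a≢k b≢k = w k

    within-twice : Twice f g a b → 2 + f b ≤ f a → Within l u f → Within l u g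
    within-twice {f} {g} {a} {b} m le w k with a ≟ k | b ≟ k
    ... | yes refl | yes refl = ⊥-elim (<-irrefl refl (≤-trans (n≤1+n _) le))
    ... | yes refl | no b≢a = ≤-trans (proj₁ (w b)) (≤-pred (≤-pred (subst (2 + f b ≤_) (sym eq) le)))
                            , ≤-trans (m≤n+m _ 2) (subst (_≤ u) (sym eq) (proj₂ (w k)))
      where eq = twice-from m (≢-sym b≢a)
    ... | no a≢b | yes refl rewrite twice-to m a≢b =
      ≤-trans (proj₁ (w b)) (m≤n+m _ 2) , ≤-trans le (proj₂ (w a))
    ... | no a≢k | no b≢k rewrite twice-off m a≢k b≢k = w k

  -- The potential of the vertex being balanced: among vectors of equal sum it is smallest when the
  -- values differ by at most one.
  squares : (Fin x → ℕ) → ℕ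
  squares f = sum λ k → f k * f k

  squares-cong : (∀ k → f k ≡ g k) → squares f ≡ squares g
  squares-cong eq = sum-cong-≗ λ k → cong (λ i → i * i) (eq k)

  private
    square-step : ∀ d i → d * d ≡ d → (d + i) * (d + i) ≡ i * i + (d + 2 * (d * i))
    square-step d i dd = trans (expand d i) (cong (λ e → i * i + (e + 2 * (d * i))) dd)
      where
      expand : ∀ d i → (d + i) * (d + i) ≡ i * i + (d * d + 2 * (d * i))
      expand = solve-∀

    pick : ∀ (c : Fin x) (f : Fin x → ℕ) k → δ c k * f k ≡ f c * δ c k
    pick c f k with c ≟ k
    ... | yes refl = *-comm (δ c c) (f c)
    ... | no c≢k = trans (cong (_* f k) (δ-≢ c≢k)) (sym (trans (cong (f c *_) (δ-≢ c≢k)) (*-zeroʳ (f c))))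

    sum-pick : ∀ (c : Fin x) (f : Fin x → ℕ) → sum (λ k → δ c k * f k) ≡ f c
    sum-pick c f = trans (sum-cong-≗ (pick c f))
      (trans (sum-*ˡ (f c) (δ c)) (trans (cong (f c *_) (sum-δ c)) (*-identityʳ (f c))))

    squares-inc : ∀ c f → squares (λ k → δ c k + f k) ≡ squares f + (1 + 2 * f c)
    squares-inc c f = begin
      sum (λ k → (δ c k + f k) * (δ c k + f k))   ≡⟨ sum-cong-≗ (λ k → square-step (δ c k) (f k) (δ-idem c k)) ⟩
      sum (λ k → f k * f k + (δ c k + 2 * (δ c k * f k)))  ≡⟨ ∑-distrib-+ (λ k → f k * f k) _ ⟩
      squares f + sum (λ k → δ c k + 2 * (δ c k * f k))    ≡⟨ cong (squares f +_) (∑-distrib-+ (δ c) _) ⟩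
      squares f + (sum (δ c) + sum (λ k → 2 * (δ c k * f k)))
        ≡⟨ cong (squares f +_) (cong₂ _+_ (sum-δ c) (trans (sum-*ˡ 2 (λ k → δ c k * f k)) (cong (2 *_) (sum-pick c f)))) ⟩
      squares f + (1 + 2 * f c) ∎
      where open ≡-Reasoning

    -- Raising `g` at `a` and raising `f` at `b` give the same vector; both sides are the sum of its
    -- squares.
    square-balance : Move f g a b → squares g + (1 + 2 * g a) ≡ squares f + (1 + 2 * f b)
    square-balance {f} {g} {a} {b} m =
      trans (sym (squares-inc a g))
            (trans (squares-cong m) (squares-inc b f))

    cancel-≤ : ∀ {A B p q} → A + p ≡ B + q → q ≤ p → A ≤ B
    cancel-≤ {A} {B} {p} {q} eq q≤p = +-cancelʳ-≤ q A B (≤-trans (+-monoʳ-≤ A q≤p) (≤-reflexive eq))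

    cancel-< : ∀ {A B p q} → A + p ≡ B + q → q < p → A < B
    cancel-< {A} {B} {p} {q} eq q<p = +-cancelʳ-< q A B (<-≤-trans (+-monoʳ-< A q<p) (≤-reflexive eq))

  -- Across a gap of one the move exchanges the two values. This is the move by which the excess
  -- travels along a fan.
  squares-move-≤ : Move f g a b → f b < f a → squares g ≤ squares f
  squares-move-≤ {f} {g} {a} {b} m lt = cancel-≤ (square-balance m)
    (+-monoʳ-≤ 1 (*-monoʳ-≤ 2 (≤-pred (subst (f b <_) (sym (move-from m λ { refl → <-irrefl refl lt })) lt))))

  squares-move-< : Move f g a b → 2 + f b ≤ f a → squares g < squares f
  squares-move-< {f} {g} {a} {b} m le = cancel-< (square-balance m)
    (+-monoʳ-< 1 (*-monoʳ-< 2 (≤-pred (subst (2 + f b ≤_)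
      (sym (move-from m λ { refl → <-irrefl refl (≤-trans (n≤1+n _) le) })) le))))

  -- The gap has to be three: across a gap of two, moving two units exchanges the two values and
  -- gains nothing.
  squares-twice-< : Twice f g a b → 3 + f b ≤ f a → squares g < squares f
  squares-twice-< {f} {g} {a} {b} m le = cancel-< balance ineq
    where
    a≢b : a ≢ b
    a≢b refl = <-irrefl refl (≤-trans (m≤n+m _ 2) le)
    twice : ∀ c (h : Fin x → ℕ) → squares (λ k → δ c k + (δ c k + h k)) ≡ squares h + ((1 + 2 * h c) + (1 + 2 * suc (h c)))
    twice c h = begin
      squares (λ k → δ c k + (δ c k + h k)) ≡⟨ squares-inc c (λ k → δ c k + h k) ⟩
      squares (λ k → δ c k + h k) + (1 + 2 * (δ c c + h c))
        ≡⟨ cong₂ (λ i j → i + (1 + 2 * (j + h c))) (squares-inc c h) (δ-refl c) ⟩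
      squares h + (1 + 2 * h c) + (1 + 2 * suc (h c)) ≡⟨ +-assoc (squares h) _ _ ⟩
      squares h + ((1 + 2 * h c) + (1 + 2 * suc (h c))) ∎
      where open ≡-Reasoning
    balance : squares g + ((1 + 2 * g a) + (1 + 2 * suc (g a))) ≡ squares f + ((1 + 2 * f b) + (1 + 2 * suc (f b)))
    balance = trans (sym (twice a g)) (trans (squares-cong m) (twice b f))
    fb<ga : f b < g a
    fb<ga = ≤-pred (≤-pred (subst (3 + f b ≤_) (sym (twice-from m a≢b)) le))
    ineq : (1 + 2 * f b) + (1 + 2 * suc (f b)) < (1 + 2 * g a) + (1 + 2 * suc (g a))
    ineq = +-mono-< (+-monoʳ-< 1 (*-monoʳ-< 2 fb<ga)) (+-monoʳ-< 1 (*-monoʳ-< 2 (s≤s fb<ga)))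

-- The effect of a trail at its ends

module _ {n x : ℕ} where

  data Outcome (E E′ : Colouring n x) (y : Fin n) (o ō : Fin x) : Set where
    closed : Twice (cnt E y) (cnt E′ y) o ō → 2 + cnt E y ō ≤ cnt E y o →
             (∀ v → v ≢ y → Same (cnt E v) (cnt E′ v)) → Outcome E E′ y o ō
    ends   : ∀ v a b → v ≢ y → (a ≡ o × b ≡ ō) ⊎ (a ≡ ō × b ≡ o) →
             Move (cnt E y) (cnt E′ y) o ō →
             Move (cnt E v) (cnt E′ v) a b → cnt E v b < cnt E v a →
             (∀ w → w ≢ y → w ≢ v → Same (cnt E w) (cnt E′ w)) → Outcome E E′ y o ō

  record Trail (E : Colouring n x) (y : Fin n) (o ō : Fin x) : Set where
    field
      E′      : Colouring n x
      outcome : Outcome E E′ y o ō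
      support : ∀ v w → is-just (lab E′ v w) ≡ is-just (lab E v w)
      keep    : ∀ v w k → k ≢ o → k ≢ ō → lab E v w ≡ just k → lab E′ v w ≡ just k

  private
    -- A trail that returned to `y` along an edge first coloured `ō` could stop there only if `o`
    -- were not more frequent than `ō` at `y`. So a closed trail moves two units in the same
    -- direction, and the stopping rule supplies the gap of two.
    outcome-of : ∀ (E E′ : Colouring n x) (y : Fin n) {o ō : Fin x} → cnt E y ō < cnt E y o →
      ∀ end {into out} → (into ≡ o × out ≡ ō) ⊎ (into ≡ ō × out ≡ o) →
      (∀ v k → I y o v k + (I end into v k + cnt E′ v k) ≡ I y ō v k + (I end out v k + cnt E v k)) →
      cnt E end out + I y o end into < cnt E end into + I y o end out → Outcome E E′ y o ō
    outcome-of E E′ y {o} {ō} lt end {into} {out} dir moves stop = result (end ≟ y) dir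
      where
      o≢ō : o ≢ ō
      o≢ō refl = <-irrefl refl lt

      away : ∀ v → v ≢ y → ∀ k → I end into v k + cnt E′ v k ≡ I end out v k + cnt E v k
      away v v≢y k = strip (I-≢ˡ (≢-sym v≢y)) (I-≢ˡ (≢-sym v≢y)) (moves v k)
        where
        strip : ∀ {i j p q} → i ≡ 0 → j ≡ 0 → i + p ≡ j + q → p ≡ q
        strip refl refl e = e

      elsewhere : ∀ v → v ≢ y → v ≢ end → Same (cnt E v) (cnt E′ v)
      elsewhere v v≢y v≢e k = trans (cong (_+ cnt E′ v k) (sym (I-≢ˡ (≢-sym v≢e))))
        (trans (away v v≢y k) (cong (_+ cnt E v k) (I-≢ˡ (≢-sym v≢e))))

      result : _ → (into ≡ o × out ≡ ō) ⊎ (into ≡ ō × out ≡ o) → Outcome E E′ y o ō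
      result (yes refl) (inj₁ (refl , refl)) = closed
        (λ k → trans (cong₂ (λ i j → i + (j + cnt E′ y k)) (sym (I-at y o k)) (sym (I-at y o k)))
                 (trans (moves y k) (cong₂ (λ i j → i + (j + cnt E y k)) (I-at y ō k) (I-at y ō k))))
        (gap (I-refl y o) (I-≢ʳ o≢ō) stop)
        (λ v v≢y → elsewhere v v≢y v≢y)
        where
        gap : ∀ {p q i j} → i ≡ 1 → j ≡ 0 → p + i < q + j → 2 + p ≤ q
        gap {p} {q} refl refl e = subst (_≤ q) (cong suc (+-comm p 1)) (subst (p + 1 <_) (+-identityʳ q) e)
      result (yes refl) (inj₂ (refl , refl)) = ⊥-elim (absurd (I-≢ʳ o≢ō) (I-refl y o) stop lt)
        where
        absurd : ∀ {p q i j} → i ≡ 0 → j ≡ 1 → p + i < q + j → q < p → ⊥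
        absurd {p} {q} refl refl e q<p =
          <-irrefl refl (<-≤-trans (subst (_< q + 1) (+-identityʳ p) e) (subst (_≤ p) (+-comm 1 q) q<p))
      result (no e≢y) d = ends end into out e≢y d
        (λ k → trans (cong₂ (λ i j → i + (j + cnt E′ y k)) (sym (I-at y o k)) (sym (I-≢ˡ e≢y)))
                 (trans (moves y k) (cong₂ (λ i j → i + (j + cnt E y k)) (I-at y ō k) (I-≢ˡ e≢y))))
        (λ k → trans (cong (_+ cnt E′ end k) (sym (I-at end into k)))
                 (trans (away end e≢y k) (cong (_+ cnt E end k) (I-at end out k))))
        (strip (I-≢ˡ (≢-sym e≢y)) (I-≢ˡ (≢-sym e≢y)) stop)
        elsewhere
        where
        strip : ∀ {p q i j} → i ≡ 0 → j ≡ 0 → p + i < q + j → p < q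
        strip {p} {q} refl refl e = +-cancelʳ-< 0 p q e

  opaque
    trail : ∀ (E : Colouring n x) (y : Fin n) (o ō : Fin x) → cnt E y ō < cnt E y o → Trail E y o ō
    trail E y o ō lt = record
      { E′ = E′ ; outcome = outcome-of E E′ y lt end dir moves stop ; support = support ; keep = keep }
      where
      W : TrailFrom E y o ō
      W = walk _ E y o ō (λ { refl → <-irrefl refl lt }) ≤-refl (≤-trans (s≤s z≤n) lt)
      open TrailFrom W

module _ {n x : ℕ} where

  Full : (Fin n → Fin n → Bool) → Colouring n x → Set
  Full adj E = ∀ v w → is-just (lab E v w) ≡ adj v w

  Tame : ℕ → ℕ → (E E′ : Colouring n x) → Fin n → Set
  Tame l u E E′ v = Within l u (cnt E v) → Within l u (cnt E′ v)

  module _ {E E′ : Colouring n x} {y : Fin n} {o ō : Fin x} where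

    outcome-tame : ∀ {l u} → Outcome E E′ y o ō → cnt E y ō < cnt E y o → ∀ v → Tame l u E E′ v
    outcome-tame (closed tw gap oth) lt v with v ≟ y
    ... | yes refl = within-twice tw gap
    ... | no v≢y = within-same (oth v v≢y)
    outcome-tame (ends e a b _ _ my me lt′ oth) lt v with v ≟ y | v ≟ e
    ... | yes refl | _ = within-move my lt
    ... | no _ | yes refl = within-move me lt′
    ... | no v≢y | no v≢e = within-same (oth v v≢y v≢e)

    outcome-from : Outcome E E′ y o ō → o ≢ ō → cnt E′ y o < cnt E y o
    outcome-from (closed tw _ _) o≢ō = ≤-trans (m≤n+m _ 1) (≤-reflexive (twice-from tw o≢ō))
    outcome-from (ends _ _ _ _ _ my _ _ _) o≢ō = ≤-reflexive (move-from my o≢ō)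

    outcome-to : Outcome E E′ y o ō → o ≢ ō → cnt E y ō < cnt E′ y ō
    outcome-to (closed tw _ _) o≢ō = ≤-trans (m≤n+m _ 1) (≤-reflexive (sym (twice-to tw o≢ō)))
    outcome-to (ends _ _ _ _ _ my _ _ _) o≢ō = ≤-reflexive (sym (move-to my o≢ō))

    outcome-off : Outcome E E′ y o ō → ∀ v {k} → o ≢ k → ō ≢ k → cnt E′ v k ≡ cnt E v k
    outcome-off (closed tw _ oth) v {k} o≢k ō≢k with v ≟ y
    ... | yes refl = twice-off tw o≢k ō≢k
    ... | no v≢y = oth v v≢y k
    outcome-off (ends e a b _ d my me _ oth) v {k} o≢k ō≢k with v ≟ y | v ≟ e | d
    ... | yes refl | _ | _ = move-off my o≢k ō≢k
    ... | no _ | yes refl | inj₁ (refl , refl) = move-off me o≢k ō≢k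
    ... | no _ | yes refl | inj₂ (refl , refl) = move-off me ō≢k o≢k
    ... | no v≢y | no v≢e | _ = oth v v≢y v≢e k

  data Ending (E E′ : Colouring n x) (y : Fin n) (a b : Fin x) : Set where
    nowhere : (∀ v → v ≢ y → Same (cnt E v) (cnt E′ v)) → Ending E E′ y a b
    at      : ∀ v → v ≢ y →
              (Move (cnt E v) (cnt E′ v) a b × cnt E v b < cnt E v a) ⊎
              (Move (cnt E v) (cnt E′ v) b a × cnt E v a < cnt E v b) →
              (∀ w → w ≢ y → w ≢ v → Same (cnt E w) (cnt E′ w)) → Ending E E′ y a b

  -- For situations where the direction of the exchange at `y` does not matter: the trail leaves `y`
  -- in the more frequent of the two colours, and what is used afterwards is `change`, which breaks
  -- an equality between counts at `y`.
  record Unbalanced (E : Colouring n x) (y : Fin n) (a b : Fin x) : Set where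
    field
      E′      : Colouring n x
      support : ∀ v w → is-just (lab E′ v w) ≡ is-just (lab E v w)
      keep    : ∀ v w {k} → a ≢ k → b ≢ k → lab E v w ≡ just k → lab E′ v w ≡ just k
      tame    : ∀ {l u} v → Tame l u E E′ v
      off     : ∀ v {k} → a ≢ k → b ≢ k → cnt E′ v k ≡ cnt E v k
      change  : cnt E′ y b ≢ cnt E y b
      ending  : Ending E E′ y a b

  unbalance : ∀ (E : Colouring n x) y {a b} → cnt E y a ≢ cnt E y b → Unbalanced E y a b
  unbalance E y {a} {b} ne = pick (<-cmp (cnt E y a) (cnt E y b))
    where
    a≢b : a ≢ b
    a≢b refl = ne refl
    pick : _ → Unbalanced E y a b
    pick (tri≈ _ eq _) = ⊥-elim (ne eq)
    pick (tri> _ _ gt) = record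
      { E′ = E′ ; support = support
      ; keep = λ v w a≢k b≢k → keep v w _ (≢-sym a≢k) (≢-sym b≢k)
      ; tame = outcome-tame outcome gt
      ; off = outcome-off outcome
      ; change = ≢-sym (<⇒≢ (outcome-to outcome a≢b))
      ; ending = ending outcome }
      where
      open Trail (trail E y a b gt)
      ending : Outcome E E′ y a b → Ending E E′ y a b
      ending (closed _ _ oth) = nowhere oth
      ending (ends v _ _ v≢y (inj₁ (refl , refl)) _ m lt oth) = at v v≢y (inj₁ (m , lt)) oth
      ending (ends v _ _ v≢y (inj₂ (refl , refl)) _ m lt oth) = at v v≢y (inj₂ (m , lt)) oth
    pick (tri< lt _ _) = record
      { E′ = E′ ; support = support
      ; keep = λ v w a≢k b≢k → keep v w _ (≢-sym b≢k) (≢-sym a≢k)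
      ; tame = outcome-tame outcome lt
      ; off = λ v a≢k b≢k → outcome-off outcome v b≢k a≢k
      ; change = <⇒≢ (outcome-from outcome (≢-sym a≢b))
      ; ending = ending outcome }
      where
      open Trail (trail E y b a lt)
      ending : Outcome E E′ y b a → Ending E E′ y a b
      ending (closed _ _ oth) = nowhere oth
      ending (ends v _ _ v≢y (inj₁ (refl , refl)) _ m lt oth) = at v v≢y (inj₂ (m , lt)) oth
      ending (ends v _ _ v≢y (inj₂ (refl , refl)) _ m lt oth) = at v v≢y (inj₁ (m , lt)) oth

  -- Trails recolour only coloured edges, so an edge without a colour is safe from them. `Put`
  -- colours it again once the trail has been made.
  module Freeze (E : Colouring n x) (z y : Fin n) {μ : Fin x} (zy : lab E z y ≡ just μ) where

    z≢y : z ≢ y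
    z≢y = edge-distinct E zy

    E₀ : Colouring n x
    E₀ = set E z y z≢y nothing

    at-z : Drop (cnt E z) (cnt E₀ z) μ
    at-z k = trans (cong₂ (λ i j → i + (j + cnt E₀ z k)) (sym (I-at z μ k)) (sym (I-≢ˡ (≢-sym z≢y))))
                   (cnt-remove E z y z≢y zy z k)

    at-y : Drop (cnt E y) (cnt E₀ y) μ
    at-y k = trans (cong₂ (λ i j → i + (j + cnt E₀ y k)) (sym (I-≢ˡ z≢y)) (sym (I-at y μ k)))
                   (cnt-remove E z y z≢y zy y k)

    away : ∀ v → v ≢ z → v ≢ y → Same (cnt E v) (cnt E₀ v)
    away v v≢z v≢y k = trans (cong₂ (λ i j → i + (j + cnt E₀ v k)) (sym (I-≢ˡ (≢-sym v≢z))) (sym (I-≢ˡ (≢-sym v≢y))))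
                             (cnt-remove E z y z≢y zy v k)

    zy₀ : lab E₀ z y ≡ nothing
    zy₀ = set-at E z y z≢y nothing

    label₀ : ∀ w {k} → w ≢ y → lab E z w ≡ just k → lab E₀ z w ≡ just k
    label₀ w w≢y eq = trans (set-other E z y z≢y nothing z w (λ h → w≢y (sym (proj₂ h))) (λ h → z≢y (sym (proj₁ h)))) eq

    module Put (F : Colouring n x) (sup : ∀ v w → is-just (lab F v w) ≡ is-just (lab E₀ v w)) (k : Fin x) where

      E₂ : Colouring n x
      E₂ = set F z y z≢y (just k)

      private
        zy₁ : lab F z y ≡ nothing
        zy₁ = unlabelled (trans (sup z y) (cong is-just zy₀))

      at-z′ : Drop (cnt E₂ z) (cnt F z) k
      at-z′ j = sym (trans (cnt-add F z y z≢y zy₁ k z j)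
                           (cong₂ (λ p q → p + (q + cnt F z j)) (I-at z k j) (I-≢ˡ (≢-sym z≢y))))

      at-y′ : Drop (cnt E₂ y) (cnt F y) k
      at-y′ j = sym (trans (cnt-add F z y z≢y zy₁ k y j)
                           (cong₂ (λ p q → p + (q + cnt F y j)) (I-≢ˡ z≢y) (I-at y k j)))

      away′ : ∀ v → v ≢ z → v ≢ y → Same (cnt F v) (cnt E₂ v)
      away′ v v≢z v≢y j = trans (cnt-add F z y z≢y zy₁ k v j)
        (cong₂ (λ p q → p + (q + cnt F v j)) (I-≢ˡ (≢-sym v≢z)) (I-≢ˡ (≢-sym v≢y)))

      support′ : ∀ v w → is-just (lab E₂ v w) ≡ is-just (lab E v w)
      support′ = put-support E F z y z≢y k (cong is-just zy) sup

      label : lab E₂ z y ≡ just k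
      label = set-at F z y z≢y (just k)

      label′ : ∀ w → w ≢ y → lab E₂ z w ≡ lab F z w
      label′ w w≢y = set-other F z y z≢y _ z w (λ h → w≢y (sym (proj₂ h))) (λ h → z≢y (sym (proj₁ h)))

      keep′ : ∀ {c} → c ≢ μ → (∀ v w → lab E₀ v w ≡ just c → lab F v w ≡ just c) →
              ∀ v w → lab E v w ≡ just c → lab E₂ v w ≡ just c
      keep′ c≢μ = put-keep E F z y z≢y k (λ eq → c≢μ (just-injective (trans (sym eq) zy)))

-- Balancing the colours at one vertex

module Improve {n x : ℕ} (adj : Fin n → Fin n → Bool) (l u : ℕ)
  (P : Fin n → Set) (P? : ∀ v → Dec (P v)) (z : Fin n) (z∉P : ¬ P z) where

  Valid : Colouring n x → Set
  Valid E = Full adj E × (∀ v → P v → Within l u (cnt E v))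

  record Better (N : ℕ) : Set where
    field
      E′     : Colouring n x
      valid  : Valid E′
      better : squares (cnt E′ z) < N

  transfer : ∀ {E E′} → Valid E → (∀ v w → is-just (lab E′ v w) ≡ is-just (lab E v w)) →
             (∀ v → v ≢ z → P v → Tame l u E E′ v) → Valid E′
  transfer (full , good) sup tame =
    (λ v w → trans (sup v w) (full v w)) , λ v Pv → tame v (λ { refl → z∉P Pv }) Pv (good v Pv)

  split : ∀ {Q : Fin n → Set} y → (P y → Q y) → (∀ v → v ≢ z → v ≢ y → Q v) → ∀ v → v ≢ z → P v → Q v
  split y qy q v v≢z Pv with v ≟ y
  ... | yes refl = qy Pv
  ... | no v≢y = q v v≢z v≢y

  record State (N : ℕ) (E : Colouring n x) (φ μ : Fin x) : Set where
    field
      valid  : Valid E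
      bound  : squares (cnt E z) ≤ N
      excess : 2 + cnt E z φ ≤ cnt E z μ

    φ≢μ : φ ≢ μ
    φ≢μ refl = <-irrefl refl (≤-trans (n≤1+n _) excess)

    won : ∀ {E′} → Valid E′ → Move (cnt E z) (cnt E′ z) μ φ → Better N
    won v m = record { valid = v ; better = <-≤-trans (squares-move-< m excess) bound }

  record Stuck (E : Colouring n x) (φ μ : Fin x) (y : Fin n) : Set where
    field
      Py      : P y
      equal   : cnt E y φ ≡ cnt E y μ
      extreme : cnt E y μ ≡ l ⊎ cnt E y μ ≡ u

  module _ {N : ℕ} {E : Colouring n x} {φ μ : Fin x} (st : State N E φ μ) where
    open State st

    recolour : ∀ {y} → lab E z y ≡ just μ → (P y → ∀ {g} → Move (cnt E y) g μ φ → Within l u g) → Better N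
    recolour {y} zy tame = won (transfer valid support′ (split y
        (λ Py _ → tame Py (drop-same-add at-y (λ _ → refl) at-y′))
        (λ v v≢z v≢y → within-same (same-trans (away v v≢z v≢y) (away′ v v≢z v≢y)))))
      (drop-same-add at-z (λ _ → refl) at-z′)
      where
      open Freeze E z y zy
      open Put E₀ (λ _ _ → refl) φ

    stuck : ∀ {y} → lab E z y ≡ just μ → Better N ⊎ Stuck E φ μ y
    stuck {y} zy with P? y
    ... | no ¬Py = inj₁ (recolour zy λ Py → ⊥-elim (¬Py Py))
    ... | yes Py with <-cmp (cnt E y φ) (cnt E y μ)
    ...   | tri< lt _ _ = inj₁ (recolour zy λ _ m → within-move m lt (proj₂ valid y Py))
    ...   | tri≈ _ eq _ with l <? cnt E y μ | cnt E y μ <? u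
    ...     | yes l< | yes <u = inj₁ (recolour zy λ _ m →
                within-spread m l< (subst (_< u) (sym eq) <u) (proj₂ valid y Py))
    ...     | no l≮ | _ = inj₂ record
                { Py = Py ; equal = eq ; extreme = inj₁ (≤-antisym (≮⇒≥ l≮) (proj₁ (proj₂ valid y Py μ))) }
    ...     | yes _ | no ≮u = inj₂ record
                { Py = Py ; equal = eq ; extreme = inj₂ (≤-antisym (proj₂ (proj₂ valid y Py μ)) (≮⇒≥ ≮u)) }
    -- Recolouring `zy` alone would widen the gap at `y`, so a `φ`/`μ`-trail from `y` avoiding `zy`
    -- compensates. If it ends in `z`, it has moved the unit there itself and `zy` keeps `μ`;
    -- otherwise `zy` becomes `φ`. At `y` at most one unit passes, from `φ` to `μ`.
    stuck {y} zy | yes Py | tri> _ _ gt = inj₁ (finish outcome)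
      where
      open Freeze E z y zy
      lt₀ : cnt E₀ y μ < cnt E₀ y φ
      lt₀ = subst₂ _≤_ (sym (drop-at at-y)) (sym (drop-off at-y (≢-sym φ≢μ))) (<⇒≤ gt)
      open Trail (trail E₀ y φ μ lt₀)
      others : ∀ {k} → ∀ v → v ≢ z → v ≢ y → Tame l u E (Put.E₂ E′ support k) v
      others {k} v v≢z v≢y w = within-same (Put.away′ E′ support k v v≢z v≢y)
        (outcome-tame outcome lt₀ v (within-same (away v v≢z v≢y) w))
      finish : Outcome E₀ E′ y φ μ → Better N
      finish (closed tw gap oth) = won
        (transfer valid support′ (split y (λ _ → within-move (drop-twice-add at-y tw at-y′) gt) others))
        (drop-same-add at-z (oth z z≢y) at-z′)
        where open Put E′ support φ
      finish (ends v a b v≢y dir my mv lt oth) with v ≟ z | dir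
      -- Even without `zy`, colour `μ` is ahead of `φ` at `z`, so the trail cannot stop at `z` in
      -- this direction.
      ... | yes refl | inj₁ (refl , refl) = ⊥-elim (<-irrefl refl (<-≤-trans lt
              (≤-trans (≤-reflexive (drop-off at-z (≢-sym φ≢μ))) (≤-pred (≤-trans (n≤1+n _)
                (≤-trans excess (≤-reflexive (sym (drop-at at-z)))))))))
      ... | yes refl | inj₂ (refl , refl) = won
              (transfer valid support′ (split y (λ _ → within-move (drop-move-restore at-y my at-y′) gt) others))
              (drop-move-restore at-z mv at-z′)
        where open Put E′ support μ
      ... | no v≢z | _ = won
              (transfer valid support′ (split y (λ _ → within-same (drop-move-add at-y my at-y′)) others))
              (drop-same-add at-z (oth z z≢y (≢-sym v≢z)) at-z′)
        where open Put E′ support φ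

  unstuck : ∀ {N E φ μ y} → State N E φ μ → lab E z y ≡ just μ → cnt E y φ ≢ cnt E y μ → Better N
  unstuck st zy ne with stuck st zy
  ... | inj₁ b = b
  ... | inj₂ s = ⊥-elim (ne (Stuck.equal s))

  state-same : ∀ {N E E′ φ μ} → State N E φ μ → Valid E′ → Same (cnt E z) (cnt E′ z) → State N E′ φ μ
  state-same {N} {φ = φ} {μ} st v s = record
    { valid = v
    ; bound = subst (_≤ N) (squares-cong (λ k → sym (s k))) bound
    ; excess = subst₂ (λ i j → 2 + i ≤ j) (sym (s φ)) (sym (s μ)) excess }
    where
    open State st

  -- If `κ` is no more frequent at `z` than `φ`, it can receive the unit in place of `φ`, and `y`
  -- does not obstruct the pair `κ`, `μ`. If `κ` is at least as frequent as `μ`, a `κ`/`φ`-trail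
  -- from `y` either ends in `z`, where it is an improvement, or leaves `z` alone and destroys the
  -- equality of `φ` and `μ` at `y`.
  middle : ∀ {N E φ μ y κ} → State N E φ μ → cnt E z μ ≡ 2 + cnt E z φ → lab E z y ≡ just μ →
           cnt E y κ ≢ cnt E y μ → Better N ⊎ cnt E z κ ≡ suc (cnt E z φ)
  middle {N} {E} {φ} {μ} {y} {κ} st exact zy ne with stuck st zy
  ... | inj₁ b = inj₁ b
  ... | inj₂ s with <-cmp (cnt E z κ) (suc (cnt E z φ))
  ...   | tri≈ _ eq _ = inj₂ eq
  ...   | tri< lt _ _ = inj₁ (unstuck record
            { valid = State.valid st ; bound = State.bound st ; excess = ≤-trans (s≤s lt) (≤-reflexive (sym exact)) } zy ne)
  ...   | tri> _ _ gt = inj₁ (finish ending)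
    where
    open State st
    κ≢μ : κ ≢ μ
    κ≢μ refl = ne refl
    high : State N E φ κ
    high = record { valid = valid ; bound = bound ; excess = gt }
    open Unbalanced (unbalance E y {κ} {φ} (λ eq → ne (trans eq (Stuck.equal s))))
    valid′ : Valid E′
    valid′ = transfer valid support (λ v _ _ → tame v)
    clash : cnt E′ y φ ≢ cnt E′ y μ
    clash eq = change (trans eq (trans (off y κ≢μ φ≢μ) (sym (Stuck.equal s))))
    retry : Same (cnt E z) (cnt E′ z) → Better N
    retry same = unstuck (state-same st valid′ same) (keep z y κ≢μ φ≢μ zy) clash
    finish : Ending E E′ y κ φ → Better N
    finish (nowhere oth) = retry (oth z (edge-distinct E zy))
    finish (at v v≢y dir oth) with v ≟ z | dir
    ... | no v≢z | _ = retry (oth z (edge-distinct E zy) (≢-sym v≢z))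
    ... | yes refl | inj₁ (m , _) = State.won high valid′ m
    ... | yes refl | inj₂ (_ , lt) = ⊥-elim (<-asym lt (≤-trans (n≤1+n _) gt))

  -- Passing the excess at `z` to the next colour

  -- The fields `keep` and `elsewhere` are what lets the rest of a fan survive: edges of other
  -- colours are untouched, and apart from `z` only `y` changes its counts.
  record Step (E : Colouring n x) (μ : Fin x) (y : Fin n) (κ : Fin x) (y₁ : Fin n) : Set where
    field
      E′        : Colouring n x
      valid     : Valid E′
      moved     : Move (cnt E z) (cnt E′ z) μ κ
      label     : lab E′ z y₁ ≡ just κ
      keep      : ∀ v w {k} → k ≢ μ → k ≢ κ → lab E v w ≡ just k → lab E′ v w ≡ just k
      elsewhere : ∀ v → v ≢ z → v ≢ y → Same (cnt E v) (cnt E′ v)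

  module _ {N E φ μ y κ y₁} (st : State N E φ μ) (exact : cnt E z μ ≡ 2 + cnt E z φ) (zy : lab E z y ≡ just μ)
           (one : cnt E z κ ≡ suc (cnt E z φ)) (zy₁ : lab E z y₁ ≡ just κ) where
    open State st

    private
      κ≢μ : κ ≢ μ
      κ≢μ refl = <-irrefl refl (≤-trans (≤-reflexive (cong suc one)) (≤-reflexive (sym exact)))

      y₁≢y : y₁ ≢ y
      y₁≢y refl = κ≢μ (just-injective (trans (sym zy₁) zy))

    step-high : P y → cnt E y κ < cnt E y μ → Step E μ y κ y₁
    step-high Py lt = record
      { E′ = E₂
      ; valid = transfer valid support′ (split y
          (λ _ → within-move (drop-same-add at-y (λ _ → refl) at-y′) lt)
          (λ v v≢z v≢y → within-same (same-trans (away v v≢z v≢y) (away′ v v≢z v≢y))))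
      ; moved = drop-same-add at-z (λ _ → refl) at-z′
      ; label = trans (label′ y₁ y₁≢y) (label₀ y₁ y₁≢y zy₁)
      ; keep = λ v w k≢μ _ → keep′ k≢μ (λ _ _ e → e) v w
      ; elsewhere = λ v v≢z v≢y → same-trans (away v v≢z v≢y) (away′ v v≢z v≢y) }
      where
      open Freeze E z y zy
      open Put E₀ (λ _ _ → refl) κ

    module _ (Py : P y) (equal : cnt E y φ ≡ cnt E y μ) (gt : cnt E y μ < cnt E y κ) where

      private
        φ≢κ : φ ≢ κ
        φ≢κ refl = <-irrefl (sym equal) gt

        module F = Freeze E z y zy
        module G = Freeze F.E₀ z y₁ (F.label₀ y₁ y₁≢y zy₁)

        E₀₀ : Colouring n x
        E₀₀ = G.E₀

        y≢z : y ≢ z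
        y≢z = ≢-sym F.z≢y
        y₁≢z : y₁ ≢ z
        y₁≢z = ≢-sym G.z≢y
        y≢y₁ : y ≢ y₁
        y≢y₁ = ≢-sym y₁≢y

        y-κ : cnt E₀₀ y κ ≡ cnt E y κ
        y-κ = trans (G.away y y≢z y≢y₁ κ) (drop-off F.at-y (≢-sym κ≢μ))
        y-μ : suc (cnt E₀₀ y μ) ≡ cnt E y μ
        y-μ = trans (cong suc (G.away y y≢z y≢y₁ μ)) (drop-at F.at-y)
        y₁-κ : suc (cnt E₀₀ y₁ κ) ≡ cnt E y₁ κ
        y₁-κ = trans (drop-at G.at-y) (F.away y₁ y₁≢z y₁≢y κ)
        y₁-μ : cnt E₀₀ y₁ μ ≡ cnt E y₁ μ
        y₁-μ = trans (drop-off G.at-y κ≢μ) (F.away y₁ y₁≢z y₁≢y μ)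
        z-κ : suc (cnt E₀₀ z κ) ≡ cnt E z κ
        z-κ = trans (drop-at G.at-z) (drop-off F.at-z (≢-sym κ≢μ))
        z-μ : suc (cnt E₀₀ z μ) ≡ cnt E z μ
        z-μ = trans (cong suc (drop-off G.at-z κ≢μ)) (drop-at F.at-z)
        z-gap : cnt E₀₀ z μ ≡ suc (cnt E₀₀ z κ)
        z-gap = suc-injective (trans z-μ (trans exact (trans (cong suc (sym one)) (cong suc (sym z-κ)))))

        lt₀ : cnt E₀₀ y μ < cnt E₀₀ y κ
        lt₀ = ≤-trans (≤-reflexive y-μ) (≤-trans (<⇒≤ gt) (≤-reflexive (sym y-κ)))

        -- Colouring zy₁ with c₁ and zy with c in a modification E₁ of E with both uncoloured.
        module Back (E₁ : Colouring n x) (sup : ∀ v w → is-just (lab E₁ v w) ≡ is-just (lab E₀₀ v w))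
                    (kp : ∀ v w k → k ≢ κ → k ≢ μ → lab E₀₀ v w ≡ just k → lab E₁ v w ≡ just k)
                    (c₁ c : Fin x) where
          module GP = G.Put E₁ sup c₁
          module FP = F.Put GP.E₂ GP.support′ c

          away : ∀ v → v ≢ z → v ≢ y → v ≢ y₁ →
                 Same (cnt E v) (cnt E₀₀ v) × Same (cnt E₁ v) (cnt FP.E₂ v)
          away v v≢z v≢y v≢y₁ =
            same-trans (F.away v v≢z v≢y) (G.away v v≢z v≢y₁) ,
            same-trans (GP.away′ v v≢z v≢y₁) (FP.away′ v v≢z v≢y)

          keep : ∀ v w {k} → k ≢ μ → k ≢ κ → lab E v w ≡ just k → lab FP.E₂ v w ≡ just k
          keep v w {k} k≢μ k≢κ = FP.keep′ k≢μ (GP.keep′ k≢κ (λ a b → kp a b k k≢κ k≢μ)) v w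

          valid₂ : (P y → Tame l u E FP.E₂ y) → (P y₁ → Tame l u F.E₀ GP.E₂ y₁) →
                   (∀ v → v ≢ z → v ≢ y → v ≢ y₁ → Tame l u E₀₀ E₁ v) → Valid FP.E₂
          valid₂ ty ty₁ t = transfer valid FP.support′ go
            where
            go : ∀ v → v ≢ z → P v → Tame l u E FP.E₂ v
            go v v≢z Pv w with v ≟ y | v ≟ y₁
            ... | yes refl | _ = ty Pv w
            ... | no _ | yes refl = within-same (FP.away′ y₁ y₁≢z y₁≢y)
                                      (ty₁ Pv (within-same (F.away y₁ y₁≢z y₁≢y) w))
            ... | no v≢y | no v≢y₁ = within-same (proj₂ (away v v≢z v≢y v≢y₁))
                              (t v v≢z v≢y v≢y₁ (within-same (proj₁ (away v v≢z v≢y v≢y₁)) w))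

          y-move : Move (cnt E₀₀ y) (cnt E₁ y) κ μ → c ≡ μ → Move (cnt E y) (cnt FP.E₂ y) κ μ
          y-move m refl = drop-move-restore F.at-y
            (move-resp (G.away y y≢z y≢y₁) (same-sym (GP.away′ y y≢z y≢y₁)) m) FP.at-y′

          y-twice : Twice (cnt E₀₀ y) (cnt E₁ y) κ μ → c ≡ κ → Move (cnt E y) (cnt FP.E₂ y) κ μ
          y-twice m refl = drop-twice-add F.at-y
            (twice-resp (G.away y y≢z y≢y₁) (same-sym (GP.away′ y y≢z y≢y₁)) m) FP.at-y′

          label₂ : lab FP.E₂ z y₁ ≡ just c₁
          label₂ = trans (FP.label′ y₁ y₁≢y) GP.label

          elsewhere₂ : Same (cnt F.E₀ y₁) (cnt GP.E₂ y₁) →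
                       (∀ v → v ≢ z → v ≢ y → v ≢ y₁ → Same (cnt E₀₀ v) (cnt E₁ v)) →
                       ∀ v → v ≢ z → v ≢ y → Same (cnt E v) (cnt FP.E₂ v)
          elsewhere₂ s₁ s v v≢z v≢y with v ≟ y₁
          ... | yes refl = same-trans (F.away y₁ y₁≢z y₁≢y) (same-trans s₁ (FP.away′ y₁ y₁≢z y₁≢y))
          ... | no v≢y₁ = same-trans (proj₁ (away v v≢z v≢y v≢y₁))
                            (same-trans (s v v≢z v≢y v≢y₁) (proj₂ (away v v≢z v≢y v≢y₁)))

        -- Being stuck requires `φ` and `μ` to be equally frequent at `y`; raising `μ` there without
        -- touching `φ` is enough to escape.
        retry : ∀ {E₂} → Valid E₂ → Same (cnt E z) (cnt E₂ z) → lab E₂ z y ≡ just μ →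
                cnt E y μ < cnt E₂ y μ → cnt E₂ y φ ≡ cnt E y φ → Better N
        retry v s eq lt same = unstuck (state-same st v s) eq
          (λ e → <-irrefl (trans (sym equal) (trans (sym same) e)) lt)

        -- The first trail has raised `κ` above a tie at `y₁`, which may take `y₁` out of range.
        -- With both edges still uncoloured, a second trail leaves `z`. If it ends in `y₁`, it
        -- repairs `y₁` and moves the unit at `z` from `μ` to `κ`, so the old colours of `zy` and
        -- `zy₁` complete the step. If it ends elsewhere, giving `zy₁` the colour `μ` undoes the
        -- changes at both `z` and `y₁`, while `μ` has risen at `y`.
        module Second (T₁ : Trail E₀₀ y κ μ)
                 (my : Move (cnt E₀₀ y) (cnt (Trail.E′ T₁) y) κ μ)
                 (m₁ : Move (cnt E₀₀ y₁) (cnt (Trail.E′ T₁) y₁) μ κ)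
                 (tie : cnt E y₁ κ ≡ cnt E y₁ μ)
                 (oth : ∀ w → w ≢ y → w ≢ y₁ → Same (cnt E₀₀ w) (cnt (Trail.E′ T₁) w)) where

          private module T = Trail T₁

          lt₂ : cnt T.E′ z κ < cnt T.E′ z μ
          lt₂ = ≤-reflexive (trans (cong suc (oth z F.z≢y G.z≢y κ)) (trans (sym z-gap) (sym (oth z F.z≢y G.z≢y μ))))

          module After (T₂′ : Trail T.E′ z μ κ) where

            module T₂ = Trail T₂′
            sup : ∀ v w → is-just (lab T₂.E′ v w) ≡ is-just (lab E₀₀ v w)
            sup v w = trans (T₂.support v w) (T.support v w)
            kp : ∀ v w k → k ≢ κ → k ≢ μ → lab E₀₀ v w ≡ just k → lab T₂.E′ v w ≡ just k
            kp v w k k≢κ k≢μ eq = T₂.keep v w k k≢μ k≢κ (T.keep v w k k≢κ k≢μ eq)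
            module B₁ = Back T₂.E′ sup kp κ μ
            module B₂ = Back T₂.E′ sup kp μ μ

            -- The second trail ends in z or y₁ only in one direction, since the counts there are known.
            y₁-κ′ : cnt T.E′ y₁ κ ≡ cnt E y₁ κ
            y₁-κ′ = trans (move-to m₁ (≢-sym κ≢μ)) y₁-κ
            y₁-μ′ : suc (cnt T.E′ y₁ μ) ≡ cnt E y₁ μ
            y₁-μ′ = trans (move-from m₁ (≢-sym κ≢μ)) y₁-μ
            y-κ′ : suc (cnt T.E′ y κ) ≡ cnt E y κ
            y-κ′ = trans (move-from my κ≢μ) y-κ
            y-μ′ : cnt T.E′ y μ ≡ cnt E y μ
            y-μ′ = trans (move-to my κ≢μ) y-μ

            tame₂ : ∀ v → v ≢ z → v ≢ y → v ≢ y₁ → Tame l u E₀₀ T₂.E′ v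
            tame₂ v v≢z v≢y v≢y₁ w = outcome-tame T₂.outcome lt₂ v (within-same (oth v v≢y v≢y₁) w)

            z-back : Move (cnt T.E′ z) (cnt T₂.E′ z) μ κ → Same (cnt E z) (cnt B₂.FP.E₂ z)
            z-back mz = drop-same-restore F.at-z
              (drop-move-add G.at-z (move-resp (oth z F.z≢y G.z≢y) (λ _ → refl) mz) B₂.GP.at-z′)
              B₂.FP.at-z′

            y₁-back : Same (cnt T.E′ y₁) (cnt T₂.E′ y₁) → Same (cnt F.E₀ y₁) (cnt B₂.GP.E₂ y₁)
            y₁-back s = drop-move-add G.at-y (move-resp (λ _ → refl) (same-sym s) m₁) B₂.GP.at-y′

            after : Outcome T.E′ T₂.E′ z μ κ → Better N ⊎ Step E μ y κ y₁
            after (closed _ gap _) = ⊥-elim (<-irrefl refl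
              (≤-trans gap (≤-reflexive (trans (oth z F.z≢y G.z≢y μ) (trans z-gap (cong suc (sym (oth z F.z≢y G.z≢y κ))))))))
            after (ends v a b v≢z dir mz mv lt oth₂) with v ≟ y₁ | dir
            ... | yes refl | inj₁ (refl , refl) = ⊥-elim (<-irrefl refl (≤-trans
                    (≤-trans (s≤s (≤-reflexive (sym y₁-κ′))) lt)
                    (≤-trans (n≤1+n _) (≤-reflexive (trans y₁-μ′ (sym tie))))))
            ... | yes refl | inj₂ (refl , refl) = inj₂ record
                    { E′ = B₁.FP.E₂
                    ; valid = B₁.valid₂ (λ _ → within-move (B₁.y-move my′ refl) gt) (λ _ → within-same s₁) tame₂
                    ; moved = drop-move-restore F.at-z
                        (drop-move-restore G.at-z (move-resp (oth z F.z≢y G.z≢y) (λ _ → refl) mz) B₁.GP.at-z′) B₁.FP.at-z′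
                    ; label = B₁.label₂
                    ; keep = B₁.keep
                    ; elsewhere = B₁.elsewhere₂ s₁ λ v v≢z v≢y v≢y₁ → same-trans (oth v v≢y v≢y₁) (oth₂ v v≢z v≢y₁) }
                  where
                  my′ : Move (cnt E₀₀ y) (cnt T₂.E′ y) κ μ
                  my′ = move-resp (λ _ → refl) (same-sym (oth₂ y y≢z y≢y₁)) my
                  s₁ : Same (cnt F.E₀ y₁) (cnt B₁.GP.E₂ y₁)
                  s₁ = drop-same-restore G.at-y (move-back m₁ mv) B₁.GP.at-y′
            ... | no v≢y₁ | d = inj₁ (at-y (v ≟ y) d)
              where
              s₁ : Same (cnt F.E₀ y₁) (cnt B₂.GP.E₂ y₁)
              s₁ = y₁-back (oth₂ y₁ y₁≢z (≢-sym v≢y₁))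
              at-y : Dec (v ≡ y) → (a ≡ μ × b ≡ κ) ⊎ (a ≡ κ × b ≡ μ) → Better N
              at-y (yes refl) (inj₁ (refl , refl)) = ⊥-elim (<-irrefl refl (<-≤-trans lt
                (≤-trans (≤-reflexive y-μ′) (≤-pred (≤-trans gt (≤-reflexive (sym y-κ′)))))))
              at-y (yes refl) (inj₂ (refl , refl)) = retry
                (B₂.valid₂ (λ _ → within-twice tw (≤-trans (s≤s (s≤s (≤-reflexive (sym y-μ′))))
                                                     (≤-trans (s≤s lt) (≤-reflexive y-κ′)))) (λ _ → within-same s₁) tame₂)
                (z-back mz) B₂.FP.label (≤-trans (n≤1+n _) (≤-reflexive (sym (twice-to tw κ≢μ))))
                (twice-off tw (≢-sym φ≢κ) (≢-sym φ≢μ))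
                where
                tw : Twice (cnt E y) (cnt B₂.FP.E₂ y) κ μ
                tw = drop-twice-restore F.at-y
                  (twice-resp (G.away y y≢z y≢y₁) (same-sym (B₂.GP.away′ y y≢z y≢y₁)) (move-move my mv)) B₂.FP.at-y′
              at-y (no v≢y) _ = retry
                (B₂.valid₂ (λ _ → within-move m gt) (λ _ → within-same s₁) tame₂)
                (z-back mz) B₂.FP.label (≤-reflexive (sym (move-to m κ≢μ))) (move-off m (≢-sym φ≢κ) (≢-sym φ≢μ))
                where
                m : Move (cnt E y) (cnt B₂.FP.E₂ y) κ μ
                m = B₂.y-move (move-resp (λ _ → refl) (same-sym (oth₂ y y≢z (≢-sym v≢y))) my) refl

            second : Better N ⊎ Step E μ y κ y₁
            second = after T₂.outcome

        module Low (T₁ : Trail E₀₀ y κ μ) where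

          module T = Trail T₁

          kp : ∀ v w k → k ≢ κ → k ≢ μ → lab E₀₀ v w ≡ just k → lab T.E′ v w ≡ just k
          kp = T.keep
          module Bκ = Back T.E′ T.support kp κ κ
          module Bμ = Back T.E′ T.support kp κ μ

          tame : ∀ v → v ≢ z → v ≢ y → v ≢ y₁ → Tame l u E₀₀ T.E′ v
          tame v _ _ _ = outcome-tame T.outcome lt₀ v

          -- The trail has left `z` alone. With `zy` and `zy₁` in their old colours its effect at
          -- `y` is to raise `μ` and not `φ`, which frees `y`.
          miss : Move (cnt E₀₀ y) (cnt T.E′ y) κ μ → Same (cnt E₀₀ z) (cnt T.E′ z) →
                 (P y₁ → Tame l u F.E₀ Bμ.GP.E₂ y₁) → Better N
          miss my sz ty₁ = retry (Bμ.valid₂ (λ _ → within-move m gt) ty₁ tame)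
            (drop-same-restore F.at-z (drop-same-restore G.at-z sz Bμ.GP.at-z′) Bμ.FP.at-z′) Bμ.FP.label
            (≤-reflexive (sym (move-to m κ≢μ))) (move-off m (≢-sym φ≢κ) (≢-sym φ≢μ))
            where
            m : Move (cnt E y) (cnt Bμ.FP.E₂ y) κ μ
            m = Bμ.y-move my refl

          tied : Move (cnt E₀₀ y) (cnt T.E′ y) κ μ → Move (cnt E₀₀ y₁) (cnt T.E′ y₁) μ κ →
                 cnt E y₁ κ ≡ cnt E y₁ μ → (∀ w → w ≢ y → w ≢ y₁ → Same (cnt E₀₀ w) (cnt T.E′ w)) →
                 Better N ⊎ Step E μ y κ y₁
          tied my m₁ tie oth = S.After.second (trail T.E′ z μ κ S.lt₂)
            where module S = Second T₁ my m₁ tie oth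

          finish : Outcome E₀₀ T.E′ y κ μ → Better N ⊎ Step E μ y κ y₁
          finish (closed tw gap oth) = inj₂ record
            { E′ = Bκ.FP.E₂
            ; valid = Bκ.valid₂ (λ _ → within-move (Bκ.y-twice tw refl) gt) (λ _ → within-same s₁) tame
            ; moved = drop-same-add F.at-z (drop-same-restore G.at-z (oth z F.z≢y) Bκ.GP.at-z′) Bκ.FP.at-z′
            ; label = Bκ.label₂
            ; keep = Bκ.keep
            ; elsewhere = Bκ.elsewhere₂ s₁ λ v _ v≢y _ → oth v v≢y }
            where
            s₁ : Same (cnt F.E₀ y₁) (cnt Bκ.GP.E₂ y₁)
            s₁ = drop-same-restore G.at-y (oth y₁ y₁≢y) Bκ.GP.at-y′
          finish (ends v a b v≢y dir my mv lt oth) with v ≟ z | v ≟ y₁ | dir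
          -- Without the two edges `μ` is still one ahead of `κ` at `z`, so a trail can end there
          -- only by moving a unit from `μ` to `κ`, and that is the required step.
          ... | yes refl | _ | inj₁ (refl , refl) = ⊥-elim (<-asym lt (≤-reflexive (sym z-gap)))
          ... | yes refl | _ | inj₂ (refl , refl) = inj₂ record
            { E′ = Bμ.FP.E₂
            ; valid = Bμ.valid₂ (λ _ → within-move (Bμ.y-move my refl) gt) (λ _ → within-same s₁) tame
            ; moved = drop-move-restore F.at-z (drop-move-restore G.at-z mv Bμ.GP.at-z′) Bμ.FP.at-z′
            ; label = Bμ.label₂
            ; keep = Bμ.keep
            ; elsewhere = Bμ.elsewhere₂ s₁ λ v v≢z v≢y _ → oth v v≢y v≢z }
            where
            s₁ : Same (cnt F.E₀ y₁) (cnt Bμ.GP.E₂ y₁)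
            s₁ = drop-same-restore G.at-y (oth y₁ y₁≢y y₁≢z) Bμ.GP.at-y′
          ... | no v≢z | no v≢y₁ | _ = inj₁ (miss my (oth z F.z≢y (≢-sym v≢z))
                  λ _ → within-same (drop-same-restore G.at-y (oth y₁ y₁≢y (≢-sym v≢y₁)) Bμ.GP.at-y′))
          ... | no v≢z | yes refl | inj₁ (refl , refl) = inj₁ (miss my (oth z F.z≢y G.z≢y)
                  λ _ → within-move (drop-move-restore G.at-y mv Bμ.GP.at-y′)
                          (≤-trans (≤-reflexive (cong suc (sym (drop-off G.at-y κ≢μ))))
                                   (≤-trans lt (≤-trans (n≤1+n _) (≤-reflexive (drop-at G.at-y))))))
          -- The trail raises `κ` at `y₁`, where `κ` was behind `μ` when `zy₁` is left out. Counting
          -- `zy₁` again, `κ` is behind or level; only the level case can take `y₁` out of range.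
          ... | no v≢z | yes refl | inj₂ (refl , refl) with <-cmp (cnt F.E₀ y₁ κ) (cnt F.E₀ y₁ μ)
          ...   | tri< lt′ _ _ = inj₁ (miss my (oth z F.z≢y G.z≢y)
                  λ _ → within-move (drop-move-restore G.at-y mv Bμ.GP.at-y′) lt′)
          ...   | tri≈ _ eq _ = tied my mv (trans (sym (F.away y₁ y₁≢z y₁≢y κ)) (trans eq (F.away y₁ y₁≢z y₁≢y μ))) oth
          ...   | tri> _ _ gt′ = ⊥-elim (<-irrefl refl (<-≤-trans gt′
                  (≤-trans (≤-reflexive (sym (drop-at G.at-y))) (≤-trans lt (≤-reflexive (drop-off G.at-y κ≢μ))))))

      -- Recolouring `zy` from `μ` to `κ` would widen the gap at `y`, so a `κ`/`μ`-trail from `y`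
      -- has to compensate. It must avoid `zy₁` as well, since the fan continues along this edge in
      -- colour `κ`.
      step-low : Better N ⊎ Step E μ y κ y₁
      step-low = Low.finish T₁ (Trail.outcome T₁)
        where
        T₁ : Trail E₀₀ y κ μ
        T₁ = trail E₀₀ y κ μ lt₀

    step : cnt E y κ ≢ cnt E y μ → Better N ⊎ Step E μ y κ y₁
    step ne with stuck st zy
    ... | inj₁ b = inj₁ b
    ... | inj₂ s with <-cmp (cnt E y κ) (cnt E y μ)
    ...   | tri< lt _ _ = inj₂ (step-high (Stuck.Py s) lt)
    ...   | tri≈ _ eq _ = ⊥-elim (ne eq)
    ...   | tri> _ _ gt = step-low (Stuck.Py s) (Stuck.equal s) gt

  -- Fans of neighbours of the unbalanced vertex

  open import Data.List.Membership.DecPropositional (_≟_ {x}) using (_∈?_)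

  -- Path E φ μ y κs λ′ e: a sequence of neighbours of z, from y to e, whose edges to z have
  -- the distinct colours μ ∷ κs (ending in λ′), each but the last one seeing different numbers of
  -- edges in its own colour and in the next one.
  data Path (E : Colouring n x) (φ : Fin x) : Fin x → Fin n → List (Fin x) → Fin x → Fin n → Set where
    end : ∀ {μ y} → lab E z y ≡ just μ → Path E φ μ y [] μ y
    via : ∀ {μ y κ y₁ κs λ′ e} → lab E z y ≡ just μ → cnt E y κ ≢ cnt E y μ → φ ≢ κ → μ ∉ κ ∷ κs →
           Path E φ κ y₁ κs λ′ e → Path E φ μ y (κ ∷ κs) λ′ e

  module _ {E : Colouring n x} {φ : Fin x} where

    head-label : ∀ {μ y κs λ′ e} → Path E φ μ y κs λ′ e → lab E z y ≡ just μ
    head-label (end eq) = eq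
    head-label (via eq _ _ _ _) = eq

    last-label : ∀ {μ y κs λ′ e} → Path E φ μ y κs λ′ e → lab E z e ≡ just λ′
    last-label (end eq) = eq
    last-label (via _ _ _ _ p) = last-label p

    last-∈ : ∀ {μ y κs λ′ e} → Path E φ μ y κs λ′ e → λ′ ∈ μ ∷ κs
    last-∈ (end _) = here refl
    last-∈ (via _ _ _ _ p) = there (last-∈ p)

    tail-∈ : ∀ {μ y κ κs λ′ e} → Path E φ μ y (κ ∷ κs) λ′ e → λ′ ∈ κ ∷ κs
    tail-∈ (via _ _ _ _ p) = last-∈ p

    φ-avoids : ∀ {μ y κs λ′ e} → Path E φ μ y κs λ′ e → ∀ {k} → k ∈ κs → φ ≢ k
    φ-avoids (via _ _ φ≢κ _ _) (here refl) = φ≢κ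
    φ-avoids (via _ _ _ _ p) (there k∈) = φ-avoids p k∈

    extend : ∀ {μ y κs λ′ e κ y₁} → Path E φ μ y κs λ′ e → lab E z y₁ ≡ just κ → cnt E e κ ≢ cnt E e λ′ →
             φ ≢ κ → κ ∉ μ ∷ κs → Path E φ μ y (κs ∷ʳ κ) κ y₁
    extend (end eq) zy₁ ne φ≢κ κ∉ =
      via eq ne φ≢κ (λ { (here refl) → κ∉ (here refl) }) (end zy₁)
    extend {κ = κ} (via {μ} {κ = κ′} {κs = κs} eq ne′ φ≢ μ∉ p) zy₁ ne φ≢κ κ∉ =
      via eq ne′ φ≢ fresh (extend p zy₁ ne φ≢κ (λ h → κ∉ (there h)))
      where
      fresh : μ ∉ κ′ ∷ (κs ∷ʳ κ)
      fresh h with ∈-++⁻ (κ′ ∷ κs) h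
      ... | inj₁ h′ = μ∉ h′
      ... | inj₂ (here refl) = κ∉ (here refl)

    lookup-injective : ∀ {μ y κs λ′ e} → Path E φ μ y κs λ′ e → ∀ {i j} →
                       lookup (μ ∷ κs) i ≡ lookup (μ ∷ κs) j → i ≡ j
    lookup-injective p {zero} {zero} eq = refl
    lookup-injective (via {κs = κs} _ _ _ μ∉ p) {zero} {suc j} refl = ⊥-elim (μ∉ (∈-lookup j))
    lookup-injective (via {κs = κs} _ _ _ μ∉ p) {suc i} {zero} refl = ⊥-elim (μ∉ (∈-lookup i))
    lookup-injective (via _ _ _ _ p) {suc i} {suc j} eq = cong suc (lookup-injective p eq)

    length-≤ : ∀ {μ y κs λ′ e} → Path E φ μ y κs λ′ e → length (μ ∷ κs) ≤ x
    length-≤ p = injective⇒≤ (lookup-injective p)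

  -- A path depends only on the labels of its edges at `z` and on the counts of its own colours at
  -- its vertices. The head is treated separately because its edge may be the one that was
  -- recoloured.
  transport : ∀ {E E′ φ μ y κs λ′ e} → lab E′ z y ≡ just μ →
    (∀ {k} → k ∈ μ ∷ κs → cnt E′ y k ≡ cnt E y k) →
    (∀ w {k} → k ∈ κs → lab E z w ≡ just k →
       lab E′ z w ≡ just k × (∀ {k′} → k′ ∈ κs → cnt E′ w k′ ≡ cnt E w k′)) →
    Path E φ μ y κs λ′ e → Path E′ φ μ y κs λ′ e
  transport eq′ same kp (end _) = end eq′
  transport eq′ same kp (via {y₁ = y₁} eq ne φ≢ μ∉ p) =
    via eq′ (λ e → ne (trans (sym (same (there (here refl)))) (trans e (same (here refl))))) φ≢ μ∉
      (transport (proj₁ rest) (proj₂ rest)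
        (λ w k∈ eq → proj₁ (kp w (there k∈) eq) , λ k′∈ → proj₂ (kp w (there k∈) eq) (there k′∈)) p)
    where rest = kp y₁ (here refl) (head-label p)

  head-∉ : ∀ {E φ μ y κs λ′ e} → Path E φ μ y κs λ′ e → μ ∉ κs
  head-∉ (end _) ()
  head-∉ (via _ _ _ μ∉ _) = μ∉

  label-≢ : ∀ (E : Colouring n x) {y w : Fin n} {μ k : Fin x} → lab E z y ≡ just μ → lab E z w ≡ just k → k ≢ μ → w ≢ y
  label-≢ _ eq eq′ k≢μ refl = k≢μ (just-injective (trans (sym eq′) eq))

  record Advanced (N : ℕ) (E : Colouring n x) (φ μ : Fin x) (y : Fin n) (κ : Fin x) (y₁ : Fin n)
                  (κs : List (Fin x)) (λ′ : Fin x) (e : Fin n) : Set where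
    field
      E′        : Colouring n x
      state     : State N E′ φ κ
      exact     : cnt E′ z κ ≡ 2 + cnt E′ z φ
      path      : Path E′ φ κ y₁ κs λ′ e
      at-e      : Same (cnt E e) (cnt E′ e)
      at-z      : ∀ {k} → k ∉ μ ∷ κ ∷ κs → cnt E′ z k ≡ cnt E z k
      φ-at-z    : cnt E′ z φ ≡ cnt E z φ

  -- Once the excess sits on `κ`, the path without its first vertex starts in the right colour
  -- again. It is intact because its vertices differ from `z` and `y`, and its later edges have
  -- colours other than `μ` and `κ`.
  advance : ∀ {N E φ μ y κ y₁ κs λ′ e} → State N E φ μ → cnt E z μ ≡ 2 + cnt E z φ →
            lab E z y ≡ just μ → cnt E y κ ≢ cnt E y μ → φ ≢ κ → μ ∉ κ ∷ κs → Path E φ κ y₁ κs λ′ e →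
            Better N ⊎ Advanced N E φ μ y κ y₁ κs λ′ e
  advance {N} {E} {φ} {μ} {y} {κ} {y₁} {κs} {λ′} {e} st exact zy ne φ≢κ μ∉ p with middle st exact zy ne
  ... | inj₁ b = inj₁ b
  ... | inj₂ one with step st exact zy one (head-label p) ne
  ...   | inj₁ b = inj₁ b
  ...   | inj₂ S = inj₂ record
    { E′ = E′
    ; state = record
        { valid = valid
        ; bound = ≤-trans (squares-move-≤ moved (≤-reflexive (trans (cong suc one) (sym exact)))) (State.bound st)
        ; excess = ≤-reflexive (sym exact′) }
    ; exact = exact′
    ; path = transport label
        (λ _ → elsewhere y₁ (≢-sym (edge-distinct E (head-label p)))
                            (label-≢ E zy (head-label p) λ { refl → μ∉ (here refl) }) _)
        (λ w k∈ eq → keep z w (λ { refl → μ∉ (there k∈) }) (λ { refl → head-∉ p k∈ }) eq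
                   , λ _ → elsewhere w (≢-sym (edge-distinct E eq)) (label-≢ E zy eq λ { refl → μ∉ (there k∈) }) _)
        p
    ; at-e = elsewhere e (≢-sym (edge-distinct E (last-label p))) (label-≢ E zy (last-label p) λ { refl → μ∉ (last-∈ p) })
    ; at-z = λ k∉ → move-off moved (λ { refl → k∉ (here refl) }) (λ { refl → k∉ (there (here refl)) })
    ; φ-at-z = φ-same }
    where
    open Step S
    φ-same : cnt E′ z φ ≡ cnt E z φ
    φ-same = move-off moved (≢-sym (State.φ≢μ st)) (≢-sym φ≢κ)
    exact′ : cnt E′ z κ ≡ 2 + cnt E′ z φ
    exact′ = trans (move-to moved (λ { refl → μ∉ (here refl) })) (cong suc (trans one (cong suc (sym φ-same))))

  -- Stuckness of the last vertex is a fact about E itself: advancing does not change the counts there.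
  follow : ∀ {N E φ μ y κs λ′ e} → State N E φ μ → cnt E z μ ≡ 2 + cnt E z φ → Path E φ μ y κs λ′ e →
           Better N ⊎ (Stuck E φ λ′ e ×
             (∀ κ → κ ∉ μ ∷ κs → cnt E e κ ≢ cnt E e λ′ → Better N ⊎ cnt E z κ ≡ suc (cnt E z φ)))
  follow st exact (end zy) with stuck st zy
  ... | inj₁ b = inj₁ b
  ... | inj₂ s = inj₂ (s , λ κ _ ne → middle st exact zy ne)
  follow {E = E} {φ} {μ} {λ′ = λ′} {e} st exact (via {κ = κ} {κs = κs} zy ne φ≢κ μ∉ p) with advance st exact zy ne φ≢κ μ∉ p
  ... | inj₁ b = inj₁ b
  ... | inj₂ adv with follow state exact′ path
    where open Advanced adv renaming (exact to exact′)
  ...   | inj₁ b = inj₁ b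
  ...   | inj₂ (s , mid) = inj₂
    ( record { Py = Stuck.Py s
             ; equal = trans (sym (at-e φ)) (trans (Stuck.equal s) (at-e λ′))
             ; extreme = subst (λ i → i ≡ l ⊎ i ≡ u) (at-e λ′) (Stuck.extreme s) }
    , λ κ′ κ′∉ ne′ → next κ′ κ′∉ (mid κ′ (λ h → κ′∉ (there h))
        (λ eq → ne′ (trans (sym (at-e κ′)) (trans eq (at-e λ′))))) )
    where
    open Advanced adv
    next : ∀ κ′ → κ′ ∉ μ ∷ κ ∷ κs → _ ⊎ cnt E′ z κ′ ≡ suc (cnt E′ z φ) → _ ⊎ cnt E z κ′ ≡ suc (cnt E z φ)
    next κ′ κ′∉ (inj₁ b) = inj₁ b
    next κ′ κ′∉ (inj₂ eq) = inj₂ (trans (sym (at-z κ′∉)) (trans eq (cong suc φ-at-z)))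

  -- A path that closes up: its last vertex e could use the first colour μ. A trail from e in the
  -- colours φ and μ that avoids the first edge of the path leaves the path intact but unsticks e.
  cycle : ∀ {N E φ μ y κ κs λ′ e} → State N E φ μ → cnt E z μ ≡ 2 + cnt E z φ →
          Path E φ μ y (κ ∷ κs) λ′ e → cnt E e μ ≢ cnt E e λ′ → Better N
  cycle {N} {E} {φ} {μ} {y} {κ} {κs} {λ′} {e} st exact path ne with follow st exact path
  ... | inj₁ b = b
  -- The one-vertex path shows that `y` is stuck too. The equality of `φ` and `μ` at `y` settles in
  -- which direction a trail avoiding `zy` can end there.
  ... | inj₂ (s , _) with follow {E = E} {φ} st exact (end (head-label path))
  ...   | inj₁ b = b
  ...   | inj₂ (s₀ , _) = finish ending
    where
    open State st
    zy : lab E z y ≡ just μ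
    zy = head-label path
    open Freeze E z y zy
    λ∈ : λ′ ∈ κ ∷ κs
    λ∈ = tail-∈ path
    μ∉ : μ ∉ κ ∷ κs
    μ∉ = head-∉ path
    λ≢μ : λ′ ≢ μ
    λ≢μ refl = μ∉ λ∈
    e≢y : e ≢ y
    e≢y = label-≢ E zy (last-label path) λ≢μ
    e≢z : e ≢ z
    e≢z = ≢-sym (edge-distinct E (last-label path))
    ne₀ : cnt E₀ e μ ≢ cnt E₀ e φ
    ne₀ eq = ne (trans (sym (away e e≢z e≢y μ)) (trans eq (trans (away e e≢z e≢y φ) (Stuck.equal s))))
    open Unbalanced (unbalance E₀ e ne₀)
    y≢e : y ≢ e
    y≢e = ≢-sym e≢y
    z≢e : z ≢ e
    z≢e = ≢-sym e≢z
    others : ∀ {k} → ∀ v → v ≢ z → v ≢ y → Tame l u E (Put.E₂ E′ support k) v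
    others {k} v v≢z v≢y w = within-same (Put.away′ E′ support k v v≢z v≢y) (tame v (within-same (away v v≢z v≢y) w))

    module M = Put E′ support μ

    again : Same (cnt E₀ z) (cnt E′ z) → Same (cnt E₀ y) (cnt E′ y) → Better N
    again sz sy = contradict (follow (state-same st valid′ z-same) exact₂ path′)
      where
      z-same : Same (cnt E z) (cnt M.E₂ z)
      z-same = drop-same-restore at-z sz M.at-z′
      y-same : Same (cnt E y) (cnt M.E₂ y)
      y-same = drop-same-restore at-y sy M.at-y′
      valid′ : Valid M.E₂
      valid′ = transfer valid M.support′ (split y (λ _ → within-same y-same) others)
      exact₂ : cnt M.E₂ z μ ≡ 2 + cnt M.E₂ z φ
      exact₂ = trans (z-same μ) (trans exact (cong (2 +_) (sym (z-same φ))))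
      off′ : ∀ v → v ≢ z → v ≢ y → ∀ {k} → μ ≢ k → φ ≢ k → cnt M.E₂ v k ≡ cnt E v k
      off′ v v≢z v≢y μ≢k φ≢k = trans (M.away′ v v≢z v≢y _) (trans (off v μ≢k φ≢k) (away v v≢z v≢y _))
      path′ : Path M.E₂ φ μ y (κ ∷ κs) λ′ e
      path′ = transport M.label (λ _ → y-same _)
        (λ w k∈ eq →
            M.keep′ (λ { refl → μ∉ k∈ }) (λ v u → keep v u (λ { refl → μ∉ k∈ }) (φ-avoids path k∈)) z w eq
          , λ k′∈ → off′ w (≢-sym (edge-distinct E eq)) (label-≢ E zy eq λ { refl → μ∉ k∈ })
                           (λ { refl → μ∉ k′∈ }) (φ-avoids path k′∈))
        path
      contradict : _ → Better N
      contradict (inj₁ b) = b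
      -- The trail has changed the count of `φ` at `e` but not that of `λ′`, so they can no longer
      -- be equal.
      contradict (inj₂ (s′ , _)) = ⊥-elim (change (trans (sym (M.away′ e e≢z e≢y φ))
        (trans (Stuck.equal s′) (trans (off′ e e≢z e≢y (≢-sym λ≢μ) (φ-avoids path λ∈))
          (trans (sym (Stuck.equal s)) (sym (away e e≢z e≢y φ)))))))

    finish : Ending E₀ E′ e μ φ → Better N
    finish (nowhere oth) = again (oth z z≢e) (oth y y≢e)
    finish (at v v≢e dir oth) with v ≟ z | v ≟ y | dir
    ... | yes refl | _ | inj₁ (m , _) = won
      (transfer valid M.support′ (split y
        (λ _ → within-same (drop-same-restore at-y (oth y y≢e (≢-sym z≢y)) M.at-y′)) others))
      (drop-move-restore at-z m M.at-z′)
    ... | yes refl | _ | inj₂ (_ , lt) = ⊥-elim (<-irrefl refl (<-≤-trans lt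
      (≤-trans (≤-reflexive (drop-off at-z (≢-sym φ≢μ)))
        (≤-pred (≤-trans (n≤1+n _) (≤-trans excess (≤-reflexive (sym (drop-at at-z)))))))))
    ... | no v≢z | yes refl | inj₁ (_ , lt) = ⊥-elim (<-irrefl refl (<-≤-trans lt
      (≤-trans (n≤1+n _) (≤-reflexive
        (trans (drop-at at-y) (trans (sym (Stuck.equal s₀)) (sym (drop-off at-y (≢-sym φ≢μ)))))))))
    -- The trail has given `y` an additional `μ` in exchange for a `φ`, so `zy` can become `φ`
    -- without any net change at `y`.
    ... | no v≢z | yes refl | inj₂ (m , _) = won
      (transfer valid support′ (split y (λ _ → within-same (drop-move-add at-y m at-y′)) others))
      (drop-same-add at-z (oth z z≢e z≢y) at-z′)
      where open Put E′ support φ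
    ... | no v≢z | no v≢y | _ = again (oth z z≢e (≢-sym v≢z)) (oth y y≢e (≢-sym v≢y))

  -- The excess is passed on until `κ` is the first colour of the remaining path, which then closes
  -- up at its own beginning.
  close : ∀ {N E φ μ y κs λ′ e κ} → State N E φ μ → cnt E z μ ≡ 2 + cnt E z φ → Path E φ μ y κs λ′ e →
          κ ∈ μ ∷ κs → cnt E e κ ≢ cnt E e λ′ → Better N
  close st exact (end _) (here refl) ne = ⊥-elim (ne refl)
  close st exact p@(via _ _ _ _ _) (here refl) ne = cycle st exact p ne
  close {λ′ = λ′} {κ = κ} st exact (via zy ne₀ φ≢ μ∉ p) (there κ∈) ne with advance st exact zy ne₀ φ≢ μ∉ p
  ... | inj₁ b = b
  ... | inj₂ adv = close state exact′ path κ∈ (λ eq → ne (trans (sym (at-e κ)) (trans eq (at-e λ′))))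
    where open Advanced adv renaming (exact to exact′)

  module _ (slack : ∀ {E : Colouring n x} → Full adj E → ∀ v → (∃ λ k → l < cnt E v k) × (∃ λ k → cnt E v k < u)) where

    -- The colours of a path are distinct, so it has at most `x` of them and the fuel cannot run out
    -- before a colour repeats. A new colour occurs at `z` by `middle`, so there is a neighbour by
    -- which to extend the path.
    search : ∀ {N E φ μ y κs λ′ e} f → f + length (μ ∷ κs) ≡ suc x → State N E φ μ → cnt E z μ ≡ 2 + cnt E z φ →
             Path E φ μ y κs λ′ e → Better N
    search zero long _ _ p = ⊥-elim (<-irrefl refl (≤-trans (≤-reflexive (sym long)) (length-≤ p)))
    search {N} {E} {φ} {μ} {y} {κs} {λ′} {e} (suc f) long st exact p with follow st exact p
    ... | inj₁ b = b
    ... | inj₂ (s , mid) = go (other (Stuck.extreme s))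
      where
      other : cnt E e λ′ ≡ l ⊎ cnt E e λ′ ≡ u → ∃ λ κ → cnt E e κ ≢ cnt E e λ′
      other (inj₁ eq) with proj₁ (slack (proj₁ (State.valid st)) e)
      ... | κ , l< = κ , λ eq′ → <-irrefl (sym (trans eq′ eq)) l<
      other (inj₂ eq) with proj₂ (slack (proj₁ (State.valid st)) e)
      ... | κ , <u = κ , λ eq′ → <-irrefl (trans eq′ eq) <u
      go : (∃ λ κ → cnt E e κ ≢ cnt E e λ′) → Better N
      go (κ , ne) with κ ∈? (μ ∷ κs)
      ... | yes κ∈ = close st exact p κ∈ ne
      ... | no κ∉ with mid κ κ∉ ne
      ...   | inj₁ b = b
      ...   | inj₂ one with neighbour E z κ (≤-trans (s≤s z≤n) (≤-reflexive (sym one)))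
      ...     | y₁ , zy₁ = search f
                  (trans (cong (f +_) (trans (cong suc (length-++ κs)) (+-comm (suc (length κs)) 1)))
                         (trans (+-suc f _) long))
                  -- The new colour is not `φ`, since `φ` and `λ′` are equally frequent at the stuck
                  -- vertex `e`.
                  st exact (extend p zy₁ ne (λ { refl → ne (Stuck.equal s) }) κ∉)

    -- With an excess of three or more any trail from `z` in the two colours lowers the potential,
    -- closed or not. An excess of exactly two could be lost to a closed trail, so it goes to the
    -- fan.
    improve : ∀ {E φ μ} → Valid E → 2 + cnt E z φ ≤ cnt E z μ → Better (squares (cnt E z))
    improve {E} {φ} {μ} valid ex with m≤n⇒m<n∨m≡n ex
    ... | inj₂ eq with neighbour E z μ (≤-trans (s≤s z≤n) ex)
    ...   | y , zy = search x (+-comm x 1) st (sym eq) (end zy)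
      where
      st : State (squares (cnt E z)) E φ μ
      st = record { valid = valid ; bound = ≤-refl ; excess = ex }
    improve {E} {φ} {μ} valid ex | inj₁ far = finish outcome
      where
      lt : cnt E z φ < cnt E z μ
      lt = ≤-trans (n≤1+n _) ex
      open Trail (trail E z μ φ lt)
      valid′ : Valid E′
      valid′ = transfer valid support (λ v _ _ → outcome-tame outcome lt v)
      finish : Outcome E E′ z μ φ → Better (squares (cnt E z))
      finish (closed tw _ _) = record { valid = valid′ ; better = squares-twice-< tw far }
      finish (ends _ _ _ _ _ m _ _ _) = record { valid = valid′ ; better = squares-move-< m ex }

-- Factorizations of graphs

countT-sum : ∀ {n} (p : Fin n → Bool) → countT p ≡ sum λ j → if p j then 1 else 0
countT-sum {n} p = trans (cong List.sum (map-tabulate {n = n} (λ j → j) f)) (sum-tabulate f)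
  where
  f : Fin n → ℕ
  f j = if p j then 1 else 0
  sum-tabulate : ∀ {m} (g : Fin m → ℕ) → List.sum (tabulate g) ≡ sum g
  sum-tabulate {zero}  g = refl
  sum-tabulate {suc m} g = cong (g zero +_) (sum-tabulate λ j → g (suc j))

<sum⇒∃ : ∀ {x} l (f : Fin x → ℕ) → l * x < sum f → ∃ λ k → l < f k
<sum⇒∃ {x} l f lx< with any? (λ k → l <? f k)
... | yes found = found
... | no none = ⊥-elim (<⇒≱ lx< (≤-trans (sum-mono-≤ {g = λ _ → l} (λ k → ≮⇒≥ λ lt → none (k , lt)))
                                         (≤-reflexive (trans (sum-const x l) (*-comm x l)))))

sum<⇒∃ : ∀ {x} u (f : Fin x → ℕ) → sum f < u * x → ∃ λ k → f k < u
sum<⇒∃ {x} u f <ux with any? (λ k → f k <? u)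
... | yes found = found
... | no none = ⊥-elim (<⇒≱ <ux (≤-trans (≤-reflexive (trans (*-comm u x) (sym (sum-const x u))))
                                         (sum-mono-≤ {f = λ _ → u} (λ k → ≮⇒≥ λ lt → none (k , lt)))))

module _ {n x : ℕ} where

  opaque
    unfolding cnt δ

    sum-cnt : ∀ (E : Colouring n x) v → sum (cnt E v) ≡ sum λ w → if is-just (lab E v w) then 1 else 0
    sum-cnt E v = trans (∑-comm (λ k w → has (lab E v w) k)) (sum-cong-≗ λ w → one (lab E v w))
      where
      one : (m : Maybe (Fin x)) → sum (has m) ≡ (if is-just m then 1 else 0)
      one (just c) = sum-δ c
      one nothing  = sum-zero {x} {has nothing} λ _ → refl

    cnt-label : ∀ (E : Colouring n (suc x)) (adj : Fin n → Fin n → Bool) →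
                Full adj E → ∀ v k →
                countT (λ w → adj v w ∧ ⌊ fromMaybe zero (lab E v w) ≟ k ⌋) ≡ cnt E v k
    cnt-label E adj full v k = trans (countT-sum λ w → adj v w ∧ ⌊ fromMaybe zero (lab E v w) ≟ k ⌋)
      (sum-cong-≗ λ w → one (lab E v w) (full v w))
      where
      one : ∀ (m : Maybe (Fin (suc x))) {c : Bool} → is-just m ≡ c →
            (if c ∧ ⌊ fromMaybe zero m ≟ k ⌋ then 1 else 0) ≡ has m k
      one (just c) refl = cong (λ b → if b then 1 else 0) (isYes≗does (c ≟ k))
      one nothing  refl = refl

module _ {n x : ℕ} (adj : Fin n → Fin n → Bool) (l u : ℕ)
  (lower : ∀ v → l * x < sum λ w → if adj v w then 1 else 0)
  (upper : ∀ v → (sum λ w → if adj v w then 1 else 0) < u * x) where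

  private
    degree-cnt : ∀ {E : Colouring n x} → Full adj E → ∀ v → sum (cnt E v) ≡ sum λ w → if adj v w then 1 else 0
    degree-cnt {E} full v = trans (sum-cnt E v) (sum-cong-≗ λ w → cong (λ b → if b then 1 else 0) (full v w))

    slack : ∀ {E : Colouring n x} → Full adj E → ∀ v → (∃ λ k → l < cnt E v k) × (∃ λ k → cnt E v k < u)
    slack {E} full v = <sum⇒∃ l (cnt E v) (subst (l * x <_) (sym (degree-cnt full v)) (lower v))
                     , sum<⇒∃ u (cnt E v) (subst (_< u * x) (sym (degree-cnt full v)) (upper v))

    module _ (P : Fin n → Set) (P? : ∀ v → Dec (P v)) (z : Fin n) (z∉P : ¬ P z) where
      open Improve {n} {x} adj l u P P? z z∉P

      balance : ∀ N E → Valid E → squares (cnt E z) < N →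
                ∃ λ E′ → Valid E′ × (∀ p q → cnt E′ z q ≤ suc (cnt E′ z p))
      balance (suc N) E valid (s≤s sq≤) with any? (λ p → any? λ q → suc (cnt E z p) <? cnt E z q)
      ... | no none = E , valid , λ p q → ≮⇒≥ λ lt → none (p , q , lt)
      ... | yes (p , q , lt) = balance N E′ valid′ (<-≤-trans better sq≤)
        where open Better (improve slack valid lt) renaming (valid to valid′)

      -- The strict degree bounds put one count above `l` and one below `u`; counts that differ by
      -- at most one then all lie in the range.
      within-z : ∀ {E : Colouring n x} → Full adj E → (∀ p q → cnt E z q ≤ suc (cnt E z p)) → Within l u (cnt E z)
      within-z full near k with slack full z
      ... | (p , l<) , (q , <u) = ≤-pred (≤-trans l< (near k p)) , ≤-trans (near q k) <u

    extend-good : ∀ i → i ≤ n → (∃ λ (E : Colouring n x) → Full adj E) →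
                  ∃ λ (E : Colouring n x) → Full adj E × (∀ v → toℕ v < i → Within l u (cnt E v))
    extend-good zero    _   (E , full) = E , full , λ _ ()
    extend-good (suc i) i<n E₀ with extend-good i (<⇒≤ i<n) E₀
    ... | E , valid with balance (λ v → toℕ v < i) (λ v → toℕ v <? i) z (<-irrefl (toℕ-fromℕ< i<n)) _ E valid ≤-refl
      where
      z : Fin n
      z = fromℕ< i<n
    ...   | E′ , (full , good) , near = E′ , full , λ v v<1+i → upto v (m≤n⇒m<n∨m≡n (≤-pred v<1+i))
      where
      upto : ∀ v → toℕ v < i ⊎ toℕ v ≡ i → Within l u (cnt E′ v)
      upto v (inj₁ v<i) = good v v<i
      upto v (inj₂ v≡i) = subst (λ w → Within l u (cnt E′ w)) (toℕ-injective (trans (toℕ-fromℕ< i<n) (sym v≡i)))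
        (within-z (λ v → toℕ v < i) (λ v → toℕ v <? i) (fromℕ< i<n) (<-irrefl (toℕ-fromℕ< i<n)) full near)

  good-colouring : (∃ λ (E : Colouring n x) → Full adj E) →
                   ∃ λ (E : Colouring n x) → Full adj E × (∀ v → Within l u (cnt E v))
  good-colouring E₀ with extend-good n ≤-refl E₀
  ... | E , full , good = E , full , λ v → good v (toℕ<n v)

factorization : ∀ {n} (G : Graph n) r a x →
  (∀ v → r * x < degree G v × degree G v < (r + a) * x) → Factorization G r a x
-- Without factors the strict upper bound would make degrees negative, so the graph has no vertices.
factorization G r a zero deg = record
  { label    = λ u → ⊥-elim (none u)
  ; labelSym = λ u → ⊥-elim (none u)
  ; degOK    = λ () }
  where
  none : ∀ u → ⊥
  none u = n≮0 (subst (degree G u <_) (*-zeroʳ (r + a)) (proj₂ (deg u)))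
factorization {n} G r a (suc x) deg = record
  -- The default label falls on non-edges only, where `adj G` masks it in `degOK`.
  { label    = λ u v → fromMaybe zero (lab E u v)
  ; labelSym = λ u v → cong (fromMaybe zero) (lab-sym E u v)
  ; degOK    = λ k v → subst (λ c → r ≤ c × c ≤ r + a) (sym (cnt-label E (adj G) full v k)) (good v k) }
  where
  -- A single colour on all edges will do, as nothing is required of vertices not yet balanced.
  start : Colouring n (suc x)
  start = record
    { lab     = λ v w → if adj G v w then just zero else nothing
    ; lab-sym = λ v w → cong (λ b → if b then just zero else nothing) (Graph.sym G v w)
    ; lab-irr = λ v → cong (λ b → if b then just zero else nothing) (irrefl G v) }
  start-full : Full (adj G) start
  start-full v w with adj G v w
  ... | true  = refl
  ... | false = refl
  coloured : ∃ λ (E : Colouring n (suc x)) → Full (adj G) E × (∀ v → Within r (r + a) (cnt E v))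
  coloured = good-colouring {x = suc x} (adj G) r (r + a)
    (λ v → subst (r * suc x <_) (countT-sum (adj G v)) (proj₁ (deg v)))
    (λ v → subst (_< (r + a) * suc x) (countT-sum (adj G v)) (proj₂ (deg v)))
    (start , start-full)
  E : Colouring n (suc x)
  E = proj₁ coloured
  full : Full (adj G) E
  full = proj₁ (proj₂ coloured)
  good : ∀ v → Within r (r + a) (cnt E v)
  good = proj₂ (proj₂ coloured)

-- Graphs for the lower bound

⟦_⟧ : Bool → ℕ
⟦ b ⟧ = if b then 1 else 0

sum-↑ : ∀ m {n} (f : Fin (m + n) → ℕ) → sum f ≡ sum (λ i → f (i ↑ˡ n)) + sum (λ j → f (m ↑ʳ j))
sum-↑ zero    f = refl
sum-↑ (suc m) f = trans (cong (f zero +_) (sum-↑ m λ i → f (suc i))) (sym (+-assoc (f zero) _ _))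

↑-elim : ∀ m {n} {Q : Fin (m + n) → Set} → (∀ i → Q (i ↑ˡ n)) → (∀ j → Q (m ↑ʳ j)) → ∀ v → Q v
↑-elim m {Q = Q} left right v with splitAt m v in eq
... | inj₁ i = subst Q (splitAt⁻¹-↑ˡ eq) (left i)
... | inj₂ j = subst Q (splitAt⁻¹-↑ʳ eq) (right j)

module _ {m n : ℕ} (G : Graph m) (H : Graph n) (cross : Fin m → Fin n → Bool) where

  private
    adjacent : Fin m ⊎ Fin n → Fin m ⊎ Fin n → Bool
    adjacent (inj₁ i) (inj₁ i′) = adj G i i′
    adjacent (inj₁ i) (inj₂ j)  = cross i j
    adjacent (inj₂ j) (inj₁ i)  = cross i j
    adjacent (inj₂ j) (inj₂ j′) = adj H j j′

    adjacent-sym : ∀ v w → adjacent v w ≡ adjacent w v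
    adjacent-sym (inj₁ i) (inj₁ i′) = Graph.sym G i i′
    adjacent-sym (inj₁ _) (inj₂ _)  = refl
    adjacent-sym (inj₂ _) (inj₁ _)  = refl
    adjacent-sym (inj₂ j) (inj₂ j′) = Graph.sym H j j′

    adjacent-irrefl : ∀ v → adjacent v v ≡ false
    adjacent-irrefl (inj₁ i) = irrefl G i
    adjacent-irrefl (inj₂ j) = irrefl H j

  glue : Graph (m + n)
  glue = record
    { adj    = λ v w → adjacent (splitAt m v) (splitAt m w)
    ; sym    = λ v w → adjacent-sym (splitAt m v) (splitAt m w)
    ; irrefl = λ v → adjacent-irrefl (splitAt m v) }

  adj-ˡˡ : ∀ i i′ → adj glue (i ↑ˡ n) (i′ ↑ˡ n) ≡ adj G i i′
  adj-ˡˡ i i′ = cong₂ adjacent (splitAt-↑ˡ m i n) (splitAt-↑ˡ m i′ n)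

  adj-ˡʳ : ∀ i j → adj glue (i ↑ˡ n) (m ↑ʳ j) ≡ cross i j
  adj-ˡʳ i j = cong₂ adjacent (splitAt-↑ˡ m i n) (splitAt-↑ʳ m n j)

  degree-ˡ : ∀ i → degree glue (i ↑ˡ n) ≡ degree G i + sum λ j → ⟦ cross i j ⟧
  degree-ˡ i = begin
    degree glue (i ↑ˡ n)  ≡⟨ countT-sum (adj glue (i ↑ˡ n)) ⟩
    sum (λ v → ⟦ adj glue (i ↑ˡ n) v ⟧)  ≡⟨ sum-↑ m _ ⟩
    sum (λ i′ → ⟦ adj glue (i ↑ˡ n) (i′ ↑ˡ n) ⟧) + sum (λ j → ⟦ adj glue (i ↑ˡ n) (m ↑ʳ j) ⟧)
      ≡⟨ cong₂ _+_ (sum-cong-≗ λ i′ → cong ⟦_⟧ (adj-ˡˡ i i′)) (sum-cong-≗ λ j → cong ⟦_⟧ (adj-ˡʳ i j)) ⟩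
    sum (λ i′ → ⟦ adj G i i′ ⟧) + sum (λ j → ⟦ cross i j ⟧)
      ≡⟨ cong (_+ sum (λ j → ⟦ cross i j ⟧)) (countT-sum (adj G i)) ⟨
    degree G i + sum (λ j → ⟦ cross i j ⟧) ∎
    where open ≡-Reasoning

  degree-ʳ : ∀ j → degree glue (m ↑ʳ j) ≡ (sum λ i → ⟦ cross i j ⟧) + degree H j
  degree-ʳ j = begin
    degree glue (m ↑ʳ j)  ≡⟨ countT-sum (adj glue (m ↑ʳ j)) ⟩
    sum (λ v → ⟦ adj glue (m ↑ʳ j) v ⟧)  ≡⟨ sum-↑ m _ ⟩
    sum (λ i → ⟦ adj glue (m ↑ʳ j) (i ↑ˡ n) ⟧) + sum (λ j′ → ⟦ adj glue (m ↑ʳ j) (m ↑ʳ j′) ⟧)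
      ≡⟨ cong₂ _+_ (sum-cong-≗ λ i → cong ⟦_⟧ (cong₂ adjacent (splitAt-↑ʳ m n j) (splitAt-↑ˡ m i n)))
                   (sum-cong-≗ λ j′ → cong ⟦_⟧ (cong₂ adjacent (splitAt-↑ʳ m n j) (splitAt-↑ʳ m n j′))) ⟩
    sum (λ i → ⟦ cross i j ⟧) + sum (λ j′ → ⟦ adj H j j′ ⟧)
      ≡⟨ cong (sum (λ i → ⟦ cross i j ⟧) +_) (countT-sum (adj H j)) ⟨
    sum (λ i → ⟦ cross i j ⟧) + degree H j ∎
    where open ≡-Reasoning

edgeless : ∀ n → Graph n
edgeless n = record { adj = λ _ _ → false ; sym = λ _ _ → refl ; irrefl = λ _ → refl }

degree-edgeless : ∀ n v → degree (edgeless n) v ≡ 0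
degree-edgeless n v = trans (countT-sum {n} λ _ → false) (sum-zero {n} {λ _ → 0} λ _ → refl)

opaque
  unfolding δ

  sum-does : ∀ {n} (i : Fin n) → sum (λ j → ⟦ does (i ≟ j) ⟧) ≡ 1
  sum-does i = sum-δ i

does-sym : ∀ {n} (i j : Fin n) → does (i ≟ j) ≡ does (j ≟ i)
does-sym i j with i ≟ j
... | yes refl = sym (dec-true (i ≟ i) refl)
... | no i≢j = sym (dec-false (j ≟ i) (≢-sym i≢j))

complete : ∀ n → Graph n
complete n = record
  { adj    = λ i j → not (does (i ≟ j))
  ; sym    = λ i j → cong not (does-sym i j)
  ; irrefl = λ i → cong not (dec-true (i ≟ i) refl) }

degree-complete : ∀ d v → degree (complete (suc d)) v ≡ d
degree-complete d v = suc-injective (begin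
  suc (degree (complete (suc d)) v)
    ≡⟨ cong₂ _+_ (sym (sum-does v)) (countT-sum (adj (complete (suc d)) v)) ⟩
  sum (λ j → ⟦ does (v ≟ j) ⟧) + sum (λ j → ⟦ not (does (v ≟ j)) ⟧)
    ≡⟨ ∑-distrib-+ {suc d} (λ j → ⟦ does (v ≟ j) ⟧) (λ j → ⟦ not (does (v ≟ j)) ⟧) ⟨
  sum (λ j → ⟦ does (v ≟ j) ⟧ + ⟦ not (does (v ≟ j)) ⟧)
    ≡⟨ sum-cong-≗ {suc d} (λ j → one (does (v ≟ j))) ⟩
  sum {suc d} (λ _ → 1)  ≡⟨ trans (sum-const (suc d) 1) (*-identityʳ (suc d)) ⟩
  suc d ∎)
  where
  open ≡-Reasoning
  one : ∀ b → ⟦ b ⟧ + ⟦ not b ⟧ ≡ 1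
  one true  = refl
  one false = refl

origin : ∀ {n} → Fin (suc n) → Bool
origin zero    = true
origin (suc _) = false

sum-origin : ∀ n → sum (λ (j : Fin (suc n)) → ⟦ origin j ⟧) ≡ 1
sum-origin n = cong suc (sum-zero {n} {λ _ → 0} λ _ → refl)

-- lopsided k has odd order, and all its degrees are 2 * k + 1 except that of the origin, which is 2 * k.
rest : ℕ → ℕ
rest zero    = 2
rest (suc k) = rest k + 2

lopsided : ∀ k → Graph (suc (rest k))
lopsided zero    = glue (edgeless 1) (complete 2) (λ _ _ → false)
-- Two new vertices, not adjacent to each other, raise every old degree by two and themselves get
-- the old order as degree, which is 2k + 3.
lopsided (suc k) = glue (lopsided k) (edgeless 2) (λ _ _ → true)

rest-2k : ∀ k → rest k ≡ 2 * suc k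
rest-2k zero    = refl
rest-2k (suc k) = trans (cong (_+ 2) (rest-2k k)) (step k)
  where
  step : ∀ k → 2 * suc k + 2 ≡ 2 * suc (suc k)
  step = solve-∀

degree-lopsided : ∀ k v → degree (lopsided k) v + ⟦ origin v ⟧ ≡ suc (2 * k)
degree-lopsided zero = ↑-elim 1
  (λ { zero → refl })
  (λ j → trans (+-identityʳ _) (trans (degree-ʳ (edgeless 1) (complete 2) (λ _ _ → false) j)
                                      (degree-complete 1 j)))
degree-lopsided (suc k) = ↑-elim (suc (rest k)) left right
  where
  left : ∀ i → degree (lopsided (suc k)) (i ↑ˡ 2) + ⟦ origin (i ↑ˡ 2) ⟧ ≡ suc (2 * suc k)
  left i = begin
    degree (lopsided (suc k)) (i ↑ˡ 2) + ⟦ origin (i ↑ˡ 2) ⟧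
      ≡⟨ cong₂ _+_ (degree-ˡ (lopsided k) (edgeless 2) (λ _ _ → true) i) (cong ⟦_⟧ (origin-↑ˡ i)) ⟩
    degree (lopsided k) i + 2 + ⟦ origin i ⟧   ≡⟨ shift (degree (lopsided k) i) ⟦ origin i ⟧ ⟩
    2 + (degree (lopsided k) i + ⟦ origin i ⟧) ≡⟨ cong (2 +_) (degree-lopsided k i) ⟩
    2 + suc (2 * k)                            ≡⟨ step k ⟩
    suc (2 * suc k)                            ∎
    where
    open ≡-Reasoning
    origin-↑ˡ : ∀ {n} (i : Fin (suc n)) → origin (i ↑ˡ 2) ≡ origin i
    origin-↑ˡ zero    = refl
    origin-↑ˡ (suc i) = refl
    shift : ∀ a b → a + 2 + b ≡ 2 + (a + b)
    shift = solve-∀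
    step : ∀ k → 2 + suc (2 * k) ≡ suc (2 * suc k)
    step = solve-∀
  right : ∀ j → degree (lopsided (suc k)) (suc (rest k) ↑ʳ j) + 0 ≡ suc (2 * suc k)
  right j = trans (+-identityʳ _) (begin
    degree (lopsided (suc k)) (suc (rest k) ↑ʳ j)
      ≡⟨ degree-ʳ (lopsided k) (edgeless 2) (λ _ _ → true) j ⟩
    sum {suc (rest k)} (λ _ → 1) + degree (edgeless 2) j
      ≡⟨ cong₂ _+_ (trans (sum-const (suc (rest k)) 1) (*-identityʳ _)) (degree-edgeless 2 j) ⟩
    suc (rest k) + 0   ≡⟨ +-identityʳ _ ⟩
    suc (rest k)       ≡⟨ cong suc (rest-2k k) ⟩
    suc (2 * suc k)    ∎)
    where open ≡-Reasoning

-- Parity of a factor on an odd set of vertices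

-- The handshake lemma: row and column zero agree by symmetry, and removing both leaves a smaller
-- symmetric matrix.
sum-symmetric-even : ∀ m (e : Fin m → Fin m → ℕ) → (∀ i j → e i j ≡ e j i) → (∀ i → e i i ≡ 0) →
                     ∃ λ h → sum (λ i → sum (e i)) ≡ 2 * h
sum-symmetric-even zero    e _ _ = 0 , refl
sum-symmetric-even (suc m) e e-sym e-irr
  with sum-symmetric-even m (λ i j → e (suc i) (suc j)) (λ i j → e-sym (suc i) (suc j)) (λ i → e-irr (suc i))
... | h , eq = row + h , (begin
  e zero zero + row + sum (λ i → e (suc i) zero + sum (λ j → e (suc i) (suc j)))
    ≡⟨ cong₂ _+_ (cong (_+ row) (e-irr zero)) (∑-distrib-+ (λ i → e (suc i) zero) _) ⟩
  row + (sum (λ i → e (suc i) zero) + sum (λ i → sum (λ j → e (suc i) (suc j))))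
    ≡⟨ cong₂ (λ p q → row + (p + q)) (sum-cong-≗ λ i → e-sym (suc i) zero) eq ⟩
  row + (row + 2 * h) ≡⟨ double row h ⟩
  2 * (row + h) ∎)
  where
  open ≡-Reasoning
  row : ℕ
  row = sum λ j → e zero (suc j)
  double : ∀ a b → a + (a + 2 * b) ≡ 2 * (a + b)
  double = solve-∀

odd-* : ∀ {m n} → Odd m → Odd n → Odd (m * n)
odd-* (i , refl) (j , refl) = i + j + 2 * (i * j) , expand i j
  where
  expand : ∀ i j → suc (2 * i) * suc (2 * j) ≡ suc (2 * (i + j + 2 * (i * j)))
  expand = solve-∀

sum-tight : ∀ {n} {f g : Fin n → ℕ} → (∀ i → g i ≤ f i) → sum f ≤ sum g → ∀ i → f i ≡ g i
sum-tight {suc n} {f} {g} g≤f tight zero = ≤-antisym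
  (+-cancelʳ-≤ _ (f zero) (g zero) (≤-trans (+-monoʳ-≤ (f zero) (sum-mono-≤ λ i → g≤f (suc i))) tight)) (g≤f zero)
sum-tight {suc n} {f} {g} g≤f tight (suc i) = sum-tight (λ i → g≤f (suc i))
  (+-cancelˡ-≤ (g zero) _ _ (≤-trans (+-monoˡ-≤ _ (g≤f zero)) tight)) i

module _ {n r a x} (G : Graph n) (F : Factorization G r a x) where
  open Factorization F

  factorDegree : Fin n → Fin x → ℕ
  factorDegree v k = countT λ w → adj G v w ∧ ⌊ label v w ≟ k ⌋

  sum-factorDegree : ∀ v → sum (factorDegree v) ≡ degree G v
  sum-factorDegree v = begin
    sum (factorDegree v)
      ≡⟨ sum-cong-≗ (λ k → countT-sum λ w → adj G v w ∧ ⌊ label v w ≟ k ⌋) ⟩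
    sum (λ k → sum λ w → ⟦ adj G v w ∧ ⌊ label v w ≟ k ⌋ ⟧)
      ≡⟨ ∑-comm (λ k w → ⟦ adj G v w ∧ ⌊ label v w ≟ k ⌋ ⟧) ⟩
    sum (λ w → sum λ k → ⟦ adj G v w ∧ ⌊ label v w ≟ k ⌋ ⟧)
      ≡⟨ sum-cong-≗ (λ w → one (adj G v w) (label v w)) ⟩
    sum (λ w → ⟦ adj G v w ⟧)  ≡⟨ countT-sum (adj G v) ⟨
    degree G v ∎
    where
    open ≡-Reasoning
    one : ∀ b (c : Fin x) → sum (λ k → ⟦ b ∧ ⌊ c ≟ k ⌋ ⟧) ≡ ⟦ b ⟧
    one true  c = trans (sum-cong-≗ λ k → cong ⟦_⟧ (isYes≗does (c ≟ k))) (sum-does c)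
    one false c = sum-zero {x} {λ _ → 0} λ _ → refl

  degree-≥ : ∀ v → x * r ≤ degree G v
  degree-≥ v = ≤-trans (≤-reflexive (sym (sum-const x r)))
    (≤-trans (sum-mono-≤ λ k → proj₁ (degOK k v)) (≤-reflexive (sum-factorDegree v)))

  degree-≤ : ∀ v → degree G v ≤ x * (r + a)
  degree-≤ v = ≤-trans (≤-reflexive (sym (sum-factorDegree v)))
    (≤-trans (sum-mono-≤ λ k → proj₂ (degOK k v)) (≤-reflexive (sum-const x (r + a))))

  factorDegree-tight : ∀ v → degree G v ≡ x * r → ∀ k → factorDegree v k ≡ r
  factorDegree-tight v eq = sum-tight (λ k → proj₁ (degOK k v))
    (≤-reflexive (trans (sum-factorDegree v) (trans eq (sym (sum-const x r)))))

-- An r-factor with r odd meets every odd cut, so an odd set of vertices of degree x * r that is left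
-- by at most one edge rules out an r-factorization with x ≥ 2 factors.
parity-obstruction : ∀ {m n r a x} (G : Graph (suc m)) (H : Graph (suc n)) cross →
  (∀ i j → cross i j ≡ true → i ≡ zero × j ≡ zero) → Odd (suc m) → Odd r → 2 ≤ x →
  (∀ (i : Fin (suc m)) → degree (glue G H cross) (i ↑ˡ suc n) ≡ x * r) → ¬ Factorization (glue G H cross) r a x
parity-obstruction {m} {n} {r} {a} {suc (suc x)} G H cross single odd-m odd-r (s≤s (s≤s _)) regular F =
  clash (odd-* odd-m odd-r) (sum-symmetric-even (suc m) e e-sym e-irr)
  where
  open Factorization F
  L : Fin (suc m) → Fin (suc m + suc n)
  L i = i ↑ˡ suc n
  R : Fin (suc n) → Fin (suc m + suc n)
  R j = suc m ↑ʳ j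

  other : ∀ (c : Fin (suc (suc x))) → ∃ λ k → c ≢ k
  other zero    = suc zero , λ ()
  other (suc c) = zero , λ ()
  -- A factor that does not contain the only possible crossing edge. It induces an `r`-regular graph
  -- on the odd side, against the handshake lemma.
  k : Fin (suc (suc x))
  k = proj₁ (other (label (L zero) (R zero)))

  e : Fin (suc m) → Fin (suc m) → ℕ
  e i i′ = ⟦ adj G i i′ ∧ ⌊ label (L i) (L i′) ≟ k ⌋ ⟧
  e-sym : ∀ i i′ → e i i′ ≡ e i′ i
  e-sym i i′ = cong₂ (λ b c → ⟦ b ∧ ⌊ c ≟ k ⌋ ⟧) (Graph.sym G i i′) (labelSym (L i) (L i′))
  e-irr : ∀ i → e i i ≡ 0
  e-irr i = cong (λ b → ⟦ b ∧ ⌊ label (L i) (L i) ≟ k ⌋ ⟧) (irrefl G i)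

  crossing : ∀ i j → ⟦ cross i j ∧ ⌊ label (L i) (R j) ≟ k ⌋ ⟧ ≡ 0
  crossing i j with cross i j in eq
  ... | false = refl
  ... | true with single i j eq
  ...   | refl , refl = cong ⟦_⟧ (trans (isYes≗does (label (L zero) (R zero) ≟ k))
                                        (dec-false (_ ≟ k) (proj₂ (other (label (L zero) (R zero))))))

  row : ∀ i → sum (e i) ≡ r
  row i = begin
    sum (e i)  ≡⟨ +-identityʳ _ ⟨
    sum (e i) + 0  ≡⟨ cong (sum (e i) +_) (sum-zero (crossing i)) ⟨
    sum (e i) + sum (λ j → ⟦ cross i j ∧ ⌊ label (L i) (R j) ≟ k ⌋ ⟧)
      ≡⟨ cong₂ _+_ (sum-cong-≗ λ i′ → cong (λ b → ⟦ b ∧ ⌊ label (L i) (L i′) ≟ k ⌋ ⟧) (adj-ˡˡ G H cross i i′))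
                   (sum-cong-≗ λ j → cong (λ b → ⟦ b ∧ ⌊ label (L i) (R j) ≟ k ⌋ ⟧) (adj-ˡʳ G H cross i j)) ⟨
    sum (λ i′ → f (L i′)) + sum (λ j → f (R j))   ≡⟨ sum-↑ (suc m) f ⟨
    sum f
      ≡⟨ countT-sum (λ w → adj (glue G H cross) (L i) w ∧ ⌊ label (L i) w ≟ k ⌋) ⟨
    factorDegree (glue G H cross) F (L i) k       ≡⟨ factorDegree-tight (glue G H cross) F (L i) (regular i) k ⟩
    r ∎
    where
    open ≡-Reasoning
    f : Fin (suc m + suc n) → ℕ
    f w = ⟦ adj (glue G H cross) (L i) w ∧ ⌊ label (L i) w ≟ k ⌋ ⟧

  clash : Odd (suc m * r) → (∃ λ h → sum (λ i → sum (e i)) ≡ 2 * h) → ⊥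
  clash (h′ , odd) (h , even) = even≢odd h h′
    (trans (sym even) (trans (trans (sum-cong-≗ row) (sum-const (suc m) r)) odd))

-- The odd part limits the number of factors from above, and the vertex `top` of largest degree
-- limits it from below.
record Obstruction (d s : ℕ) : Set where
  field
    {m n}   : ℕ
    G       : Graph (suc m)
    H       : Graph (suc n)
    cross   : Fin (suc m) → Fin (suc n) → Bool
    single  : ∀ i j → cross i j ≡ true → i ≡ zero × j ≡ zero
    odd     : Odd (suc m)
    regular : ∀ (i : Fin (suc m)) → degree (glue G H cross) (i ↑ˡ suc n) ≡ d
    degrees : ∀ (j : Fin (suc n)) → degree (glue G H cross) (suc m ↑ʳ j) ≡ d ⊎ degree (glue G H cross) (suc m ↑ʳ j) ≡ d + s
    top     : Fin (suc n)
    at-top  : degree (glue G H cross) (suc m ↑ʳ top) ≡ d + s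

  whole : Graph (suc m + suc n)
  whole = glue G H cross

  bounded : IsDegBounded d s whole
  bounded = ↑-elim (suc m)
    (λ i → ≤-reflexive (sym (regular i)) , ≤-trans (≤-reflexive (regular i)) (m≤m+n d s))
    λ j → right j (degrees j)
    where
    right : ∀ j → _ → d ≤ degree whole (suc m ↑ʳ j) × degree whole (suc m ↑ʳ j) ≤ d + s
    right j (inj₁ eq) = ≤-reflexive (sym eq) , ≤-trans (≤-reflexive eq) (m≤m+n d s)
    right j (inj₂ eq) = ≤-trans (m≤m+n d s) (≤-reflexive (sym eq)) , ≤-reflexive eq

parity : ∀ d → (∃ λ k → d ≡ 2 * k) ⊎ Odd d
parity zero = inj₁ (0 , refl)
parity (suc d) with parity d
... | inj₁ (k , eq) = inj₂ (k , cong suc eq)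
... | inj₂ (k , eq) = inj₁ (suc k , trans (cong suc eq) (sym (*-suc 2 k)))

opaque
  -- For even `d` the complete graph on `d + 1` vertices is an odd component. For odd `d` no
  -- `d`-regular graph has odd order, so one edge must leave the odd set: a bridge makes up for the
  -- deficient vertex of `lopsided k`. A complete component supplies degree `d + s`.
  obstruction : ∀ d s → Obstruction d s
  obstruction d s with parity d
  ... | inj₁ (k , even) = record
    { m = d ; n = d + s ; G = complete (suc d) ; H = complete (suc (d + s)) ; cross = λ _ _ → false
    ; single = λ _ _ () ; odd = k , cong suc even
    ; regular = λ i → trans (degree-ˡ (complete (suc d)) (complete (suc (d + s))) (λ _ _ → false) i)
        (trans (cong₂ _+_ (degree-complete d i) (sum-zero {suc (d + s)} {λ _ → 0} λ _ → refl)) (+-identityʳ d))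
    ; degrees = λ j → inj₂ (top j) ; top = zero ; at-top = top zero }
    where
    top : ∀ (j : Fin (suc (d + s))) →
          degree (glue (complete (suc d)) (complete (suc (d + s))) (λ _ _ → false)) (suc d ↑ʳ j) ≡ d + s
    top j = trans (degree-ʳ (complete (suc d)) (complete (suc (d + s))) (λ _ _ → false) j)
      (cong₂ _+_ (sum-zero {suc d} {λ _ → 0} λ _ → refl) (degree-complete (d + s) j))
  ... | inj₂ (k , refl) = record
    { m = rest k ; n = rest k + suc (suc (2 * k) + s) ; G = lopsided k ; H = H ; cross = bridge
    ; single = single ; odd = suc k , cong suc (rest-2k k)
    ; regular = λ i → trans (degree-ˡ (lopsided k) H bridge i)
        (trans (cong (degree (lopsided k) i +_) (row {n = rest k + suc (suc (2 * k) + s)} i)) (degree-lopsided k i))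
    ; degrees = ↑-elim (suc (rest k)) (λ i → inj₁ (low i)) (λ j → inj₂ (high j))
    ; top = suc (rest k) ↑ʳ zero ; at-top = high zero }
    where
    K : Graph (suc (suc (2 * k) + s))
    K = complete (suc (suc (2 * k) + s))
    -- The other end of the bridge is the deficient vertex of a second copy, so it also reaches
    -- degree `d`.
    H : Graph (suc (rest k) + suc (suc (2 * k) + s))
    H = glue (lopsided k) K (λ _ _ → false)
    bridge : ∀ {m n} → Fin (suc m) → Fin (suc n) → Bool
    bridge i j = origin i ∧ origin j
    single : ∀ {m n} (i : Fin (suc m)) (j : Fin (suc n)) → bridge i j ≡ true → i ≡ zero × j ≡ zero
    single zero zero _ = refl , refl
    row : ∀ {m n} (i : Fin (suc m)) → sum (λ (j : Fin (suc n)) → ⟦ bridge i j ⟧) ≡ ⟦ origin i ⟧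
    row {n = n} zero    = sum-origin n
    row {n = n} (suc i) = sum-zero {suc n} {λ _ → 0} λ _ → refl
    col : ∀ {m n} (j : Fin (suc n)) → sum (λ (i : Fin (suc m)) → ⟦ bridge i j ⟧) ≡ ⟦ origin j ⟧
    col {m} zero    = trans (sum-cong-≗ {suc m} λ i → cong ⟦_⟧ (∧-true (origin i))) (sum-origin m)
      where
      ∧-true : ∀ b → b ∧ true ≡ b
      ∧-true true  = refl
      ∧-true false = refl
    col {m} (suc j) = sum-zero {suc m} λ i → cong ⟦_⟧ (∧-zeroʳ (origin i))
    low : ∀ (i : Fin (suc (rest k))) →
          degree (glue (lopsided k) H bridge) (suc (rest k) ↑ʳ (i ↑ˡ suc (suc (2 * k) + s))) ≡ suc (2 * k)
    low i = trans (degree-ʳ (lopsided k) H bridge (i ↑ˡ suc (suc (2 * k) + s)))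
      (trans (cong₂ _+_ (trans (col {rest k} (i ↑ˡ suc (suc (2 * k) + s))) (cong ⟦_⟧ (origin-↑ˡ i)))
                        (trans (degree-ˡ (lopsided k) K (λ _ _ → false) i)
                               (trans (cong (degree (lopsided k) i +_)
                                            (sum-zero {suc (suc (2 * k) + s)} {λ _ → 0} λ _ → refl))
                                      (+-identityʳ _))))
             (trans (+-comm ⟦ origin i ⟧ _) (degree-lopsided k i)))
      where
      origin-↑ˡ : ∀ {m n} (i : Fin (suc m)) → origin (i ↑ˡ n) ≡ origin i
      origin-↑ˡ zero    = refl
      origin-↑ˡ (suc i) = refl
    high : ∀ (j : Fin (suc (suc (2 * k) + s))) →
           degree (glue (lopsided k) H bridge) (suc (rest k) ↑ʳ (suc (rest k) ↑ʳ j)) ≡ suc (2 * k) + s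
    high j = trans (degree-ʳ (lopsided k) H bridge (suc (rest k) ↑ʳ j))
      (trans (cong₂ _+_ (col {rest k} (suc (rest k) ↑ʳ j)) (degree-ʳ (lopsided k) K (λ _ _ → false) j))
             (cong₂ _+_ (sum-zero {suc (rest k)} {λ _ → 0} λ _ → refl) (degree-complete (suc (2 * k) + s) j)))

-- The bounds on σ

<[m/n]*n+n : ∀ m n → m < m / suc n * suc n + suc n
<[m/n]*n+n m n = subst (_< m / suc n * suc n + suc n) (sym (m≡m%n+[m/n]*n m (suc n)))
  (<-≤-trans (+-monoˡ-< (m / suc n * suc n) (m%n<n m (suc n))) (≤-reflexive (+-comm (suc n) _)))

⌈⌉-≥ : ∀ m k → m ≤ ⌈ m / suc k ⌉ * suc k
⌈⌉-≥ m k = +-cancelʳ-≤ (suc k) m _ (subst (_≤ ⌈ m / suc k ⌉ * suc k + suc k) (sym (+-suc m k)) (<[m/n]*n+n (m + k) k))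

⌈⌉-< : ∀ m k → ⌈ m / suc k ⌉ * suc k < m + suc k
⌈⌉-< m k = ≤-trans (s≤s (m/n*n≤m (m + k) (suc k))) (≤-reflexive (sym (+-suc m k)))

-- The t largest integers x with x * r < d.
many-values : ∀ r′ a s t′ q d → suc r′ * suc t′ + s ≤ q * a → suc r′ * q + t′ * suc r′ + 1 ≤ d →
  Σ (Fin (suc t′) → ℕ) λ xs → Injective _≡_ _≡_ xs × (∀ i → d + s ≤ xs i * (suc r′ + a) × xs i * suc r′ < d)
many-values r′ a s t′ q zero _ d≥ = ⊥-elim (n≮0 (subst (_≤ 0) (+-comm _ 1) d≥))
many-values r′ a s t′ q (suc d) q≥ d≥ = xs
  , (λ {i} {j} eq → toℕ-injective (∸-cancelˡ-≡ (i≤X i) (i≤X j) eq))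
  , λ i → low i , high i
  where
  r = suc r′
  -- Here `d` is the predecessor of the given number, so `X` is the largest `x` with `x * r`
  -- strictly below that number.
  X = d / r
  xs : Fin (suc t′) → ℕ
  xs i = X ∸ toℕ i
  X≥ : q + t′ ≤ X
  X≥ = ≤-pred (*-cancelʳ-< r (q + t′) (suc X) (≤-<-trans
         (≤-trans (≤-reflexive (expand q t′ r)) (≤-pred (subst (_≤ suc d) (+-comm _ 1) d≥)))
         (<-≤-trans (<[m/n]*n+n d r′) (≤-reflexive (+-comm (X * r) r)))))
    where
    expand : ∀ q t r → (q + t) * r ≡ r * q + t * r
    expand = solve-∀
  i≤t : ∀ i → toℕ {suc t′} i ≤ t′
  i≤t i = ≤-pred (toℕ<n i)
  i≤X : ∀ i → toℕ {suc t′} i ≤ X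
  i≤X i = ≤-trans (i≤t i) (≤-trans (m≤n+m t′ q) X≥)
  q≤ : ∀ i → q ≤ xs i
  q≤ i = m+n≤o⇒m≤o∸n q (≤-trans (+-monoʳ-≤ q (i≤t i)) X≥)
  high : ∀ i → xs i * r < suc d
  high i = s≤s (≤-trans (*-monoˡ-≤ r (m∸n≤m X (toℕ i))) (m/n*n≤m d r))
  low : ∀ i → suc d + s ≤ xs i * (r + a)
  low i = begin
    suc d + s                           ≤⟨ +-monoˡ-≤ s (<[m/n]*n+n d r′) ⟩
    X * r + r + s                       ≡⟨ cong (λ X → X * r + r + s) (m∸n+n≡m (i≤X i)) ⟨
    (x + toℕ i) * r + r + s             ≤⟨ +-monoˡ-≤ s (+-monoˡ-≤ r (*-monoˡ-≤ r (+-monoʳ-≤ x (i≤t i)))) ⟩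
    (x + t′) * r + r + s                ≡⟨ collect x t′ r s ⟩
    x * r + (r * suc t′ + s)            ≤⟨ +-monoʳ-≤ (x * r) (≤-trans q≥ (*-monoˡ-≤ a (q≤ i))) ⟩
    x * r + x * a                       ≡⟨ *-distribˡ-+ x r a ⟨
    x * (r + a)                         ∎
    where
    open ≤-Reasoning
    x = xs i
    collect : ∀ x t r s → (x + t) * r + r + s ≡ x * r + (r * suc t + s)
    collect = solve-∀

-- The admissible values are taken for `suc s` instead of `s`, which turns the weak inequality at
-- the largest degree into the strict one that `factorization` needs. This is the origin of the
-- additional 1 under the ceiling.
upper-bound : ∀ r′ a s t′ q → suc r′ * suc t′ + suc s ≤ q * a →
              SigmaProp (suc r′) s a (suc t′) (suc r′ * q + t′ * suc r′ + 1)
upper-bound r′ a s t′ q q≥ d d≥ n G bounded with many-values r′ a (suc s) t′ q d q≥ d≥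
... | xs , inj , good = xs , inj , λ i → factorization G (suc r′) a (xs i) λ v →
    ≤-trans (s≤s (≤-reflexive (*-comm (suc r′) (xs i)))) (≤-trans (proj₂ (good i)) (proj₁ (bounded v)))
  , ≤-trans (s≤s (proj₂ (bounded v))) (≤-trans (≤-reflexive (sym (+-suc d s)))
      (≤-trans (proj₁ (good i)) (≤-reflexive (*-comm (xs i) (suc r′ + a)))))

no-injection : ∀ {t q} (xs : Fin (suc t) → ℕ) → Injective _≡_ _≡_ xs →
               (∀ i → q ≤ xs i) → (∀ i → xs i < q + t) → ⊥
no-injection {t} {q} xs inj lo hi = clash (pigeonhole (n<1+n t) (λ i → fromℕ< (shifted i)))
  where
  shifted : ∀ i → xs i ∸ q < t
  shifted i = +-cancelˡ-< q _ _ (subst (_< q + t) (sym (m+[n∸m]≡n (lo i))) (hi i))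
  clash : (∃ λ i → ∃ λ j → toℕ i < toℕ j × fromℕ< (shifted i) ≡ fromℕ< (shifted j)) → ⊥
  clash (i , j , i<j , eq) = <⇒≢ i<j (cong toℕ (inj (∸-cancelʳ-≡ (lo i) (lo j)
    (trans (sym (toℕ-fromℕ< _)) (trans (cong toℕ eq) (toℕ-fromℕ< _))))))

-- The degree `(q + t′) * r` is one less than the claimed bound. Vertices of degree `d + s` need at
-- least `q` factors, those of degree `d` allow at most `q + t′`, and the value `q + t′` itself
-- falls to parity; only `t′` values remain.
lower-bound : ∀ r′ a s t′ q → Odd (suc r′) → q * a < suc t′ * suc r′ + s + a → 2 ≤ q + t′ →
              ∀ d₀ → SigmaProp (suc r′) s a (suc t′) d₀ → suc r′ * q + t′ * suc r′ + 1 ≤ d₀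
lower-bound r′ a s t′ q odd-r q< two d₀ prop = ≮⇒≥ λ lt →
  clash (prop d (≤-pred (≤-trans lt (≤-reflexive (+-comm d 1)))) _ whole bounded)
  where
  r = suc r′
  d = r * q + t′ * r
  d≡ : d ≡ (q + t′) * r
  d≡ = expand q t′ r
    where
    expand : ∀ q t r → r * q + t * r ≡ (q + t) * r
    expand = solve-∀
  open Obstruction (obstruction d s)

  above : ∀ {x} → Factorization whole r a x → q ≤ x
  above {x} F = ≮⇒≥ λ x<q → <-irrefl refl (begin-strict
    x * (r + a) + (r + a)   ≡⟨ +-comm _ (r + a) ⟩
    suc x * (r + a)         ≤⟨ *-monoˡ-≤ (r + a) x<q ⟩
    q * (r + a)             ≡⟨ *-distribˡ-+ q r a ⟩
    q * r + q * a           <⟨ +-monoʳ-< (q * r) q< ⟩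
    q * r + (suc t′ * r + s + a)  ≡⟨ collect q r t′ s a ⟩
    r * q + t′ * r + s + (r + a)   ≡⟨ cong (_+ (r + a)) at-top ⟨
    degree whole (suc m ↑ʳ top) + (r + a)  ≤⟨ +-monoˡ-≤ (r + a) (degree-≤ whole F (suc m ↑ʳ top)) ⟩
    x * (r + a) + (r + a)         ∎)
    where
    open ≤-Reasoning
    collect : ∀ q r t s a → q * r + (suc t * r + s + a) ≡ r * q + t * r + s + (r + a)
    collect = solve-∀

  below : ∀ {x} → Factorization whole r a x → x < q + t′
  below {x} F = ≤∧≢⇒<
    (*-cancelʳ-≤ x (q + t′) r (≤-trans (degree-≥ whole F (zero ↑ˡ suc n)) (≤-reflexive (trans (regular zero) d≡))))
    λ x≡ → parity-obstruction G H cross single odd odd-r (subst (2 ≤_) (sym x≡) two)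
             (λ i → trans (regular i) (trans d≡ (cong (_* r) (sym x≡)))) F

  clash : ManyFactorizations whole r a (suc t′) → ⊥
  clash (xs , inj , F) = no-injection xs inj (λ i → above (F i)) (λ i → below (F i))

theorem28 : (r s a t : ℕ) → Odd r → Odd a →
    (2 ≤ t ⊎ (t ≡ 1 × a < r * t + s)) →
    SigmaBetween r s a t
    (r * ⌈ t * r + s / a ⌉ + (t ∸ 1) * r + 1)
    (r * ⌈ t * r + s + 1 / a ⌉ + (t ∸ 1) * r + 1)
    × (∀ d → r * ⌈ r * t + s / a ⌉ + (t ∸ 1) * r + 1 ≤ d →
    Σ (Fin t → ℕ) λ xs → Injective _≡_ _≡_ xs ×
    (∀ i → d + s ≤ xs i * (r + a) × xs i * r < d))
theorem28 r s a zero _ _ (inj₁ ())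
theorem28 r s a zero _ _ (inj₂ (() , _))
theorem28 r@.(suc (2 * ρ)) s a@.(suc (2 * α)) (suc t) odd-r@(ρ , refl) (α , refl) large =
    ( upper-bound (2 * ρ) a s t ⌈ suc t * r + s + 1 / a ⌉
        (≤-trans (≤-reflexive (reorder r (suc t) s)) (⌈⌉-≥ (suc t * r + s + 1) (2 * α)))
    , lower-bound (2 * ρ) a s t ⌈ suc t * r + s / a ⌉ odd-r (⌈⌉-< (suc t * r + s) (2 * α)) (two large) )
  , λ d → many-values (2 * ρ) a s t ⌈ r * suc t + s / a ⌉ d (⌈⌉-≥ (r * suc t + s) (2 * α))
  where
  reorder : ∀ r t s → r * t + suc s ≡ t * r + s + 1
  reorder = solve-∀
  q = ⌈ suc t * r + s / a ⌉
  total≤ : suc t * r + s ≤ q * a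
  total≤ = ⌈⌉-≥ (suc t * r + s) (2 * α)
  -- The parity argument needs two factors. For a single value of `x` the hypothesis on `a` makes
  -- the ceiling `q` at least 2; otherwise `q ≥ 1` and `t ≥ 1` suffice.
  two : 2 ≤ suc t ⊎ (suc t ≡ 1 × a < r * suc t + s) → 2 ≤ q + t
  two (inj₁ (s≤s 1≤t)) = +-mono-≤ (*-cancelʳ-< a 0 q (≤-trans (s≤s z≤n) total≤)) 1≤t
  two (inj₂ (refl , a<)) = ≤-trans (*-cancelʳ-< a 1 q (≤-trans (s≤s (≤-reflexive (+-identityʳ a)))
    (≤-trans (subst (a <_) (cong (_+ s) (*-comm r 1)) a<) total≤))) (m≤m+n q 0)
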